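{- Let $0<|q|<1$ and define \[ \vartheta_4(a_0,a_1,a_2,a_3):=\frac{1}{4J_4}\Big[a_0\,\overline{J}_{4,8}\overline{J}_{6,16}+a_1\,q^2\overline{J}_{0,8}\overline{J}_{14,16}+a_2\,q\,\overline{J}_{4,8}\overline{J}_{14,16}+a_3\,q\,\overline{J}_{0,8}\overline{J}_{6,16}\Big]. \] Then \begin{align*} D_C(0,4)&=\vartheta_4(3,-1,1,-3),\\ D_C(1,4)=D_C(3,4)&=\vartheta_4(-1,-1,1,1),\\ D_C(2,4)&=\vartheta_4(-1,3,-3,1). \end{align*}
   Context: Throughout $q$ is complex with $0<|q|<1$. Notation: $(x;q)_\infty=\prod_{i\ge0}(1-xq^i)$, $j(x;q)=(x;q)_\infty(q/x;q)_\infty(q;q)_\infty=\sum_{n\in\mathbb Z}(-1)^nq^{\binom n2}x^n$; for integers $a$ and $m>0$, $J_{a,m}=j(q^a;q^m)$, $\overline{J}_{a,m}=j(-q^a;q^m)$, $J_m=\prod_{i\ge1}(1-q^{mi})$. Let $C(m,n)$ be defined by $\sum_{n\ge0}\sum_{m\in\mathbb Z}C(m,n)z^mq^n=\prod_{n\ge1}\frac{1-q^n}{(1-zq^n)(1-z^{ -1}q^n)}$ (the crank generating function of Andrews–Garvan). For a positive integer $M$ let $C(a,M;n)=\sum_{m\equiv a\ (\mathrm{mod}\ M)}C(m,n)$, let $p(n)$ be the number of partitions of $n$ ($p(0)=1$), and define the crank deviation $D_C(a,M)=\sum_{n\ge0}\big(C(a,M;n)-p(n)/M\big)q^n$; equivalently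 $D_C(a,M)=\frac1M\sum_{j=1}^{M-1}\zeta_M^{ -aj}\frac{(q;q)_\infty}{(\zeta_M^jq;q)_\infty(\zeta_M^{ -j}q;q)_\infty}$ with $\zeta_M$ a primitive $M$-th root of unity. -}

module Defs where

open import Data.Nat as ℕ using (ℕ; zero; suc; NonZero)
import Data.Nat.DivMod as ℕD
open import Data.Integer as ℤ using (ℤ; +_)
open import Data.Integer.DivMod using (_%ℕ_)
open import Data.Rational as ℚ using (ℚ; 0ℚ; 1ℚ)
open import Data.List using (List; []; _∷_; _++_; map; concatMap; length; foldr; upTo)
open import Data.Product using (_×_; _,_)
open import Data.Bool using (if_then_else_)
open import Relation.Nullary.Decidable using (⌊_⌋)

-- Formal power series in q over a ring-like carrier A.
-- (For 0<|q|<1 all series below converge absolutely, and the analytic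
--  identities are equivalent to coefficientwise identities.)

module PS {A : Set} (0# 1# : A) (_⊕_ _⊗_ : A → A → A) (⊖_ : A → A) where

  Series : Set
  Series = ℕ → A

  sumTo : (ℕ → A) → ℕ → A
  sumTo f zero    = f zero
  sumTo f (suc n) = sumTo f n ⊕ f (suc n)

  _+ₛ_ : Series → Series → Series
  (f +ₛ g) n = f n ⊕ g n

  _*ₛ_ : Series → Series → Series
  (f *ₛ g) n = sumTo (λ k → f k ⊗ g (n ℕ.∸ k)) n

  constₛ : A → Series
  constₛ c zero    = c
  constₛ c (suc n) = 0#

  oneₛ : Series
  oneₛ = constₛ 1#

  mono : A → ℕ → Series
  mono c e n = if ⌊ n ℕ.≟ e ⌋ then c else 0#

  scaleₛ : A → Series → Series
  scaleₛ c f n = c ⊗ f n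

  shiftₛ : ℕ → Series → Series
  shiftₛ e f = mono 1# e *ₛ f

  powA : A → ℕ → A
  powA x zero    = 1#
  powA x (suc k) = x ⊗ powA x k

  -- 1/(1 - x q^(suc e)) = Σ_k x^k q^(k(suc e))
  geom : A → ℕ → Series
  geom x e n = if ⌊ n ℕ.% suc e ℕ.≟ 0 ⌋ then powA x (n ℕ./ suc e) else 0#

  prodUpTo : (ℕ → Series) → ℕ → Series
  prodUpTo F zero    = F zero
  prodUpTo F (suc k) = prodUpTo F k *ₛ F (suc k)

  -- Infinite product ∏_{i≥0} F i, valid when F i ≡ 1 (mod q^i) for i ≥ 1
  -- (true for every product used below): the q^n coefficient of the
  -- infinite product equals that of the finite product up to i = n.
  infProd : (ℕ → Series) → Series
  infProd F n = prodUpTo F n n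

  -- (c q^a ; q^m)_∞ = ∏_{i≥0} (1 - c q^(a + m i)),  used with m ≥ 1
  poch : A → ℕ → ℕ → Series
  poch c a m = infProd (λ i → oneₛ +ₛ mono (⊖ c) (a ℕ.+ m ℕ.* i))

open PS 0ℚ 1ℚ ℚ._+_ ℚ._*_ ℚ.-_ public

J : ℕ → Series
J m = poch 1ℚ m m

invJ4 : Series
invJ4 = infProd (λ i → geom 1ℚ (4 ℕ.* suc i ℕ.∸ 1))

-- Jbar_{a,m} = j(-q^a ; q^m) = (-q^a;q^m)_∞ (-q^(m-a);q^m)_∞ (q^m;q^m)_∞
-- (used only with 0 ≤ a ≤ m)
Jbar : ℕ → ℕ → Series
Jbar a m = (poch (ℚ.- 1ℚ) a m *ₛ poch (ℚ.- 1ℚ) (m ℕ.∸ a) m) *ₛ J m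

toℚ : ℤ → ℚ
toℚ z = z ℚ./ 1

ϑ₄ : ℤ → ℤ → ℤ → ℤ → Series
ϑ₄ a0 a1 a2 a3 =
  scaleₛ (+ 1 ℚ./ 4)
    (invJ4 *ₛ
      (((scaleₛ (toℚ a0) (Jbar 4 8 *ₛ Jbar 6 16)
      +ₛ scaleₛ (toℚ a1) (shiftₛ 2 (Jbar 0 8 *ₛ Jbar 14 16)))
      +ₛ scaleₛ (toℚ a2) (shiftₛ 1 (Jbar 4 8 *ₛ Jbar 14 16)))
      +ₛ scaleₛ (toℚ a3) (shiftₛ 1 (Jbar 0 8 *ₛ Jbar 6 16))))

-- Laurent polynomials in z with integer coefficients, represented as a
-- finite formal sum Σ c z^e given by a list of pairs (e , c).

LP : Set
LP = List (ℤ × ℤ)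

_⊕L_ : LP → LP → LP
_⊕L_ = _++_

_⊗L_ : LP → LP → LP
p ⊗L r = concatMap (λ { (e , c) → map (λ { (e' , c') → (e ℤ.+ e' , c ℤ.* c') }) r }) p

⊖L_ : LP → LP
⊖L p = map (λ { (e , c) → (e , ℤ.- c) }) p

module LPS = PS [] ((+ 0 , + 1) ∷ []) _⊕L_ _⊗L_ ⊖L_

z z⁻¹ : LP
z   = (+ 1 , + 1) ∷ []
z⁻¹ = (ℤ.- (+ 1) , + 1) ∷ []

crankGF : LPS.Series
crankGF = LPS.poch ((+ 0 , + 1) ∷ []) 1 1
  LPS.*ₛ (LPS.infProd (λ i → LPS.geom z i)
  LPS.*ₛ LPS.infProd (λ i → LPS.geom z⁻¹ i))

coeffL : ℤ → LP → ℤ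
coeffL m = foldr (λ { (e , c) s → if ⌊ e ℤ.≟ m ⌋ then c ℤ.+ s else s }) (+ 0)

C : ℤ → ℕ → ℤ
C m n = coeffL m (crankGF n)

-- C(a,M;n) = Σ_{m ≡ a (mod M)} C(m,n)  (the sum of all terms c z^e of
-- the q^n coefficient with e ≡ a mod M; a finite sum)
Cmod : ℤ → (M : ℕ) → .{{NonZero M}} → ℕ → ℤ
Cmod a M n =
  foldr (λ { (e , c) s → if ⌊ (e ℤ.- a) %ℕ M ℕ.≟ 0 ⌋ then c ℤ.+ s else s })
        (+ 0) (crankGF n)

-- Partitions: all nonincreasing lists of positive integers summing to n.
-- partsF fuel n k = partitions of n with all parts ≤ k (fuel ≥ n suffices).

partsF : ℕ → ℕ → ℕ → List (List ℕ)
partsF _        zero    _ = [] ∷ []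
partsF zero     (suc n) _ = []
partsF (suc f)  (suc n) k =
  concatMap (λ j → map (suc j ∷_) (partsF f (suc n ℕ.∸ suc j) (suc j)))
            (upTo (ℕ._⊓_ k (suc n)))

partitions : ℕ → List (List ℕ)
partitions n = partsF n n n

p : ℕ → ℕ
p n = length (partitions n)

D_C : ℤ → (M : ℕ) → .{{NonZero M}} → Series
D_C a M n = toℚ (Cmod a M n) ℚ.- (+ p n ℚ./ M)

{-# OPTIONS --safe #-}

-- Evaluating the crank generating function at z = 1, -1, i gives the three series
--   P = 1/J₁,   B = J₁ (q;q²)²,   A = J₁ (q;q²)(-q;q²)
-- (the last two by Euler's (q;q²)(-q;q) = 1), and with c_a = Σ C(a,4;n) qⁿ the characters mod 4 yield
--   c₀+c₁+c₂+c₃ = P,   c₀-c₁+c₂-c₃ = B,   c₀-c₂ = A,   c₁ = c₃.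
-- On the theta side, splitting the bilateral series of a Jacobi triple product by the parity of the summation index gives
--   J̄₄,₈ - q J̄₀,₈ = j(q;q²) = (q;q²)² J₂,   J̄₆,₁₆ ± q J̄₁₄,₁₆ = j(∓q;q⁴) = (∓q;q²) J₄.
-- Multiplying these out expresses J₄ A and J₄ B as signed sums of the four products in ϑ₄, and the rest is linear algebra.
-- The triple product itself is the limit of the finite identity
--   ∏_{i<M} (1 + s q^{a+mi}) ∏_{i<N} (1 + s q^{b+mi}) = Σ_k [M+N choose N+k]_{q^m} s^k q^{mk(k-1)/2 + ak},   a + b = m, s² = 1,
-- proved from the q-Pascal rules.

module Submission where

open import Defs using (module PS; LP; _⊕L_; _⊗L_; ⊖L_; module LPS; z; z⁻¹; crankGF; toℚ; Cmod; D_C; p; partsF; ϑ₄)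

open import Algebra.Bundles using (CommutativeRing; CommutativeSemiring)
import Algebra.Properties.CommutativeSemigroup as CommutativeSemigroupProperties
import Algebra.Properties.Ring as RingProperties
import Algebra.Solver.Ring.NaturalCoefficients.Default as SemiringSolver
open import Algebra.Structures using (IsCommutativeRing)
open import Data.Bool using (true; false; if_then_else_)
open import Data.Integer as ℤ using (ℤ; +_; -[1+_]; -_)
open import Data.Integer.DivMod using (_%ℕ_)
import Data.Integer.Properties as ℤ
open import Data.List using (List; []; _∷_; _++_; map; length; foldr; concatMap; upTo)
open import Data.List.Properties using (upTo-∷ʳ; concatMap-++; length-++; length-map; ++-identityʳ)
open import Data.Nat as ℕ using (ℕ; zero; suc; _∸_; _≤_; _<_; z≤n; s≤s)
open import Data.Nat.DivMod using ([m+n]%n≡m%n; +-distrib-/-∣ˡ; n/n≡1; m<n⇒m%n≡m)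
open import Data.Nat.Divisibility using (∣-refl)
import Data.Nat.Properties as ℕ
open import Data.Nat.Tactic.RingSolver using () renaming (solve to ℕ-solve)
open import Data.Product using (_×_; _,_; proj₁; proj₂)
open import Data.Rational as ℚ using (ℚ; 0ℚ; 1ℚ; toℚᵘ)
import Data.Rational.Properties as ℚ
open import Data.Rational.Solver using (module +-*-Solver)
open import Data.Rational.Unnormalised as ℚᵘ using (mkℚᵘ; *≡*; _≃_)
import Data.Rational.Unnormalised.Properties as ℚᵘ
open import Data.Sum using (inj₁; inj₂)
open import Function using (_∘_; case_of_)
open import Level using (0ℓ)
open import Relation.Binary.Bundles using (Setoid)
open import Relation.Binary.PropositionalEquality as ≡ using (_≡_; refl; cong; cong₂; module ≡-Reasoning)
import Relation.Binary.Reasoning.Setoid as SetoidReasoning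
open import Relation.Binary.Structures using (IsEquivalence)
open import Relation.Nullary.Decidable using (⌊_⌋; yes; no; isYes≗does)

-- Limits are replaced by congruences modulo q^(n+1), written `_≈[_]_`: `infProd` reads each
-- coefficient off a finite product, so every analytic step becomes a statement about truncations.
-- The bilateral index k is kept as a pair of naturals with k = i - N, which keeps all exponents in
-- ℕ; s² = 1 gives s^k a meaning for negative k. Laurent polynomials are lists and do not form a
-- commutative ring up to `≡`, so the crank series itself is never transformed: it is evaluated
-- first, and all identities are proved for its values. The same products occur over ℚ and over
-- ℚ[i], hence the series theory is developed over an arbitrary commutative ring. The value at i
-- turns out to be a product with rational coefficients. The vanishing of its imaginary part is the
-- source of c₁ = c₃, and its real part is an identity over ℚ.

double : ℕ → ℕ
double zero    = zero
double (suc n) = suc (suc (double n))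

n≤double : ∀ n → n ≤ double n
n≤double zero    = z≤n
n≤double (suc n) = s≤s (ℕ.m≤n⇒m≤1+n (n≤double n))

-- Formal power series

module Antidiagonal (R : CommutativeSemiring 0ℓ 0ℓ) where

  open CommutativeSemiring R renaming (Carrier to B; refl to ≈-refl)
  open CommutativeSemigroupProperties +-commutativeSemigroup using (interchange)
  open SetoidReasoning setoid

  -- Both indices with i + j = n are passed to f, so convolution recurses on constructors instead of
  -- truncated subtraction. The carrier is a semiring because the sums run over coefficients and,
  -- later, over whole series.
  antidiag : (ℕ → ℕ → B) → ℕ → B
  antidiag f zero    = f 0 0
  antidiag f (suc n) = f 0 (suc n) + antidiag (λ i j → f (suc i) j) n

  antidiag-snoc : ∀ f n → antidiag f (suc n) ≈ antidiag (λ i j → f i (suc j)) n + f (suc n) 0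
  antidiag-snoc f zero    = ≈-refl
  antidiag-snoc f (suc n) = trans (+-congˡ (antidiag-snoc (λ i j → f (suc i) j) n)) (sym (+-assoc _ _ _))

  antidiag-cong : ∀ {f g} n → (∀ i j → i ℕ.+ j ≡ n → f i j ≈ g i j) → antidiag f n ≈ antidiag g n
  antidiag-cong zero    f≈g = f≈g 0 0 refl
  antidiag-cong (suc n) f≈g =
    +-cong (f≈g 0 (suc n) refl) (antidiag-cong n λ i j e → f≈g (suc i) j (cong suc e))

  antidiag-+ : ∀ f g n → antidiag (λ i j → f i j + g i j) n ≈ antidiag f n + antidiag g n
  antidiag-+ f g zero    = ≈-refl
  antidiag-+ f g (suc n) = trans (+-congˡ (antidiag-+ _ _ n)) (interchange _ _ _ _)

  antidiag-*ˡ : ∀ c f n → antidiag (λ i j → c * f i j) n ≈ c * antidiag f n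
  antidiag-*ˡ c f zero    = ≈-refl
  antidiag-*ˡ c f (suc n) = trans (+-congˡ (antidiag-*ˡ c _ n)) (sym (distribˡ _ _ _))

  antidiag-comm : ∀ f n → antidiag f n ≈ antidiag (λ i j → f j i) n
  antidiag-comm f zero    = ≈-refl
  antidiag-comm f (suc n) = begin
    f 0 (suc n) + antidiag (λ i j → f (suc i) j) n  ≈⟨ +-congˡ (antidiag-comm _ n) ⟩
    f 0 (suc n) + antidiag (λ i j → f (suc j) i) n  ≈⟨ +-comm _ _ ⟩
    antidiag (λ i j → f (suc j) i) n + f 0 (suc n)  ≈⟨ antidiag-snoc (λ i j → f j i) n ⟨
    antidiag (λ i j → f j i) (suc n)                ∎

  antidiag-0 : ∀ n → antidiag (λ _ _ → 0#) n ≈ 0#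
  antidiag-0 zero    = ≈-refl
  antidiag-0 (suc n) = trans (+-identityˡ _) (antidiag-0 n)

  -- Summed form of a Pascal rule. An interior entry receives one contribution from each of g and h;
  -- at each of the two ends only one contribution exists. With the q-Pascal rules it yields the
  -- recurrences of the finite theta sum.
  antidiag-pascal : ∀ f g h n → f 0 (suc n) ≈ h 0 n → f (suc n) 0 ≈ g n 0 →
                    (∀ i j → suc i ℕ.+ j ≡ n → f (suc i) (suc j) ≈ g i (suc j) + h (suc i) j) →
                    antidiag f (suc n) ≈ antidiag g n + antidiag h n
  antidiag-pascal f g h zero    f≈h f≈g _     = trans (+-cong f≈h f≈g) (+-comm _ _)
  antidiag-pascal f g h (suc n) f≈h f≈g inner = begin
    f 0 (suc (suc n)) + antidiag (λ i j → f (suc i) j) (suc n)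
      ≈⟨ +-congˡ (antidiag-snoc (λ i j → f (suc i) j) n) ⟩
    f 0 (suc (suc n)) + (antidiag (λ i j → f (suc i) (suc j)) n + f (suc (suc n)) 0)
      ≈⟨ +-cong f≈h (+-cong (trans (antidiag-cong n (λ i j e → inner i j (cong suc e))) (antidiag-+ _ _ n)) f≈g) ⟩
    h 0 (suc n) + ((antidiag (λ i j → g i (suc j)) n + antidiag (λ i j → h (suc i) j) n) + g (suc n) 0)
      ≈⟨ +-congˡ (trans (+-congʳ (+-comm _ _)) (+-assoc _ _ _)) ⟩
    h 0 (suc n) + (antidiag (λ i j → h (suc i) j) n + (antidiag (λ i j → g i (suc j)) n + g (suc n) 0))
      ≈⟨ +-assoc _ _ _ ⟨
    antidiag h (suc n) + (antidiag (λ i j → g i (suc j)) n + g (suc n) 0)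
      ≈⟨ +-comm _ _ ⟩
    (antidiag (λ i j → g i (suc j)) n + g (suc n) 0) + antidiag h (suc n)
      ≈⟨ +-congʳ (antidiag-snoc g n) ⟨
    antidiag g (suc n) + antidiag h (suc n) ∎

module PowerSeries {A : Set} {_⊕_ _⊗_ : A → A → A} {⊖_ : A → A} {0# 1# : A}
                   (isCR : IsCommutativeRing _≡_ _⊕_ _⊗_ ⊖_ 0# 1#) where

  open PS 0# 1# _⊕_ _⊗_ ⊖_ public

  coefficients : CommutativeRing 0ℓ 0ℓ
  coefficients = record { isCommutativeRing = isCR }

  private
    module A where
      open CommutativeRing coefficients public

  open Antidiagonal A.commutativeSemiring public

  sumTo-cong : ∀ {f g} n → (∀ k → k ≤ n → f k ≡ g k) → sumTo f n ≡ sumTo g n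
  sumTo-cong zero    f≡g = f≡g 0 z≤n
  sumTo-cong (suc n) f≡g =
    cong₂ _⊕_ (sumTo-cong n λ k k≤n → f≡g k (ℕ.m≤n⇒m≤1+n k≤n)) (f≡g (suc n) ℕ.≤-refl)

  sumTo-antidiag : ∀ f n → sumTo (λ k → f k (n ∸ k)) n ≡ antidiag f n
  sumTo-antidiag f zero    = refl
  sumTo-antidiag f (suc n) = begin
    sumTo (λ k → f k (suc n ∸ k)) n ⊕ f (suc n) (n ∸ n)
      ≡⟨ cong₂ _⊕_ (sumTo-cong n λ k k≤n → cong (f k) (ℕ.+-∸-assoc 1 k≤n)) (cong (f (suc n)) (ℕ.n∸n≡0 n)) ⟩
    sumTo (λ k → f k (suc (n ∸ k))) n ⊕ f (suc n) 0
      ≡⟨ cong (_⊕ f (suc n) 0) (sumTo-antidiag (λ i j → f i (suc j)) n) ⟩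
    antidiag (λ i j → f i (suc j)) n ⊕ f (suc n) 0
      ≡⟨ antidiag-snoc f n ⟨
    antidiag f (suc n) ∎
    where open ≡-Reasoning

  conv : Series → Series → Series
  conv f g = antidiag (λ i j → f i ⊗ g j)

  conv-cong : ∀ {f f′ g g′} n → (∀ k → k ≤ n → f k ≡ f′ k) → (∀ k → k ≤ n → g k ≡ g′ k) →
              conv f g n ≡ conv f′ g′ n
  conv-cong n f≡f′ g≡g′ = antidiag-cong n λ i j e →
    cong₂ _⊗_ (f≡f′ i (≡.subst (i ≤_) e (ℕ.m≤m+n i j))) (g≡g′ j (≡.subst (j ≤_) e (ℕ.m≤n+m j i)))

  conv-comm : ∀ f g n → conv f g n ≡ conv g f n
  conv-comm f g n = ≡.trans (antidiag-comm _ n) (antidiag-cong n λ i j _ → A.*-comm (f j) (g i))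

  conv-distribˡ : ∀ f g h n → conv f (g +ₛ h) n ≡ conv f g n ⊕ conv f h n
  conv-distribˡ f g h n =
    ≡.trans (antidiag-cong n λ i j _ → A.distribˡ (f i) (g j) (h j)) (antidiag-+ _ _ n)

  conv-distribʳ : ∀ f g h n → conv (g +ₛ h) f n ≡ conv g f n ⊕ conv h f n
  conv-distribʳ f g h n =
    ≡.trans (antidiag-cong n λ i j _ → A.distribʳ (f j) (g i) (h i)) (antidiag-+ _ _ n)

  conv-scaleˡ : ∀ c f g n → conv (scaleₛ c f) g n ≡ c ⊗ conv f g n
  conv-scaleˡ c f g n = ≡.trans (antidiag-cong n λ i j _ → A.*-assoc c (f i) (g j)) (antidiag-*ˡ c _ n)

  conv-zeroˡ : ∀ f n → conv (λ _ → 0#) f n ≡ 0#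
  conv-zeroˡ f n = ≡.trans (antidiag-cong n λ _ j _ → A.zeroˡ (f j)) (antidiag-0 n)

  conv-constˡ : ∀ c f n → conv (constₛ c) f n ≡ c ⊗ f n
  conv-constˡ c f zero    = refl
  conv-constˡ c f (suc n) = ≡.trans (cong ((c ⊗ f (suc n)) ⊕_) (conv-zeroˡ f n)) (A.+-identityʳ _)

  -- Induction on n through f = f 0 + q (f ∘ suc): the shifted tail of `conv f g` unfolds to the
  -- series `scaleₛ (f 0) (g ∘ suc) +ₛ conv (f ∘ suc) g`, and the second summand is handled by the
  -- hypothesis for `f ∘ suc`.
  conv-assoc : ∀ f g h n → conv (conv f g) h n ≡ conv f (conv g h) n
  conv-assoc f g h zero    = A.*-assoc _ _ _
  conv-assoc f g h (suc n) = begin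
    ((f 0 ⊗ g 0) ⊗ h (suc n)) ⊕ conv (scaleₛ (f 0) (g ∘ suc) +ₛ conv (f ∘ suc) g) h n
      ≡⟨ cong (((f 0 ⊗ g 0) ⊗ h (suc n)) ⊕_) (conv-distribʳ h (scaleₛ (f 0) (g ∘ suc)) (conv (f ∘ suc) g) n) ⟩
    ((f 0 ⊗ g 0) ⊗ h (suc n)) ⊕ (conv (scaleₛ (f 0) (g ∘ suc)) h n ⊕ conv (conv (f ∘ suc) g) h n)
      ≡⟨ cong₂ _⊕_ (A.*-assoc _ _ _) (cong₂ _⊕_ (conv-scaleˡ (f 0) (g ∘ suc) h n) (conv-assoc (f ∘ suc) g h n)) ⟩
    (f 0 ⊗ (g 0 ⊗ h (suc n))) ⊕ ((f 0 ⊗ conv (g ∘ suc) h n) ⊕ conv (f ∘ suc) (conv g h) n)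
      ≡⟨ A.+-assoc _ _ _ ⟨
    ((f 0 ⊗ (g 0 ⊗ h (suc n))) ⊕ (f 0 ⊗ conv (g ∘ suc) h n)) ⊕ conv (f ∘ suc) (conv g h) n
      ≡⟨ cong (_⊕ conv (f ∘ suc) (conv g h) n) (A.distribˡ _ _ _) ⟨
    (f 0 ⊗ conv g h (suc n)) ⊕ conv (f ∘ suc) (conv g h) n ∎
    where open ≡-Reasoning

  infix 4 _≈_ _≈[_]_

  record _≈_ (f g : Series) : Set where
    constructor ptwise
    field at : ∀ n → f n ≡ g n
  open _≈_ public

  -- Congruence modulo q^(n+1), the stand-in for q-adic limits.
  record _≈[_]_ (f : Series) (n : ℕ) (g : Series) : Set where
    constructor ptwise
    field below : ∀ k → k ≤ n → f k ≡ g k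
  open _≈[_]_ public

  infixl 7 _*_
  infixl 6 _+_

  -- Opaque, so that unification can read the factors off a product.
  opaque
    _+_ _*_ : Series → Series → Series
    _+_ = _+ₛ_
    _*_ = _*ₛ_

    +-def : ∀ f g n → (f + g) n ≡ f n ⊕ g n
    +-def _ _ _ = refl

    *-def : ∀ f g → f *ₛ g ≈ f * g
    *-def _ _ = ptwise λ _ → refl

    *-conv : ∀ f g n → (f * g) n ≡ conv f g n
    *-conv f g n = sumTo-antidiag (λ i j → f i ⊗ g j) n

    +ₛ-def : ∀ f g → f +ₛ g ≈ f + g
    +ₛ-def _ _ = ptwise λ _ → refl

  ≈⇒≈[] : ∀ {f g n} → f ≈ g → f ≈[ n ] g
  ≈⇒≈[] (ptwise e) = ptwise λ k _ → e k

  ≈[]⇒≈ : ∀ {f g} → (∀ n → f ≈[ n ] g) → f ≈ g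
  ≈[]⇒≈ e = ptwise λ n → below (e n) n ℕ.≤-refl

  ≈-isEquivalence : IsEquivalence _≈_
  ≈-isEquivalence = record
    { refl  = ptwise λ _ → refl
    ; sym   = λ (ptwise e) → ptwise λ n → ≡.sym (e n)
    ; trans = λ (ptwise e) (ptwise e′) → ptwise λ n → ≡.trans (e n) (e′ n)
    }

  ≈[]-setoid : ℕ → Setoid 0ℓ 0ℓ
  ≈[]-setoid n = record
    { Carrier = Series
    ; _≈_ = _≈[ n ]_
    ; isEquivalence = record
      { refl  = ptwise λ _ _ → refl
      ; sym   = λ (ptwise e) → ptwise λ k k≤n → ≡.sym (e k k≤n)
      ; trans = λ (ptwise e) (ptwise e′) → ptwise λ k k≤n → ≡.trans (e k k≤n) (e′ k k≤n)
      }
    }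

  module ≈[] {n : ℕ} = Setoid (≈[]-setoid n)

  ≈[]-weaken : ∀ {f g m n} → m ≤ n → f ≈[ n ] g → f ≈[ m ] g
  ≈[]-weaken m≤n (ptwise e) = ptwise λ k k≤m → e k (ℕ.≤-trans k≤m m≤n)

  +-cong[] : ∀ {n f f′ g g′} → f ≈[ n ] f′ → g ≈[ n ] g′ → f + g ≈[ n ] f′ + g′
  +-cong[] {n} {f} {f′} {g} {g′} (ptwise e) (ptwise e′) = ptwise λ k k≤n →
    ≡.trans (+-def f g k) (≡.trans (cong₂ _⊕_ (e k k≤n) (e′ k k≤n)) (≡.sym (+-def f′ g′ k)))

  *-cong[] : ∀ {n f f′ g g′} → f ≈[ n ] f′ → g ≈[ n ] g′ → f * g ≈[ n ] f′ * g′
  *-cong[] {n} {f} {f′} {g} {g′} (ptwise e) (ptwise e′) = ptwise λ k k≤n →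
    ≡.trans (*-conv f g k) (≡.trans
      (conv-cong k (λ i i≤k → e i (ℕ.≤-trans i≤k k≤n)) (λ i i≤k → e′ i (ℕ.≤-trans i≤k k≤n)))
      (≡.sym (*-conv f′ g′ k)))

  private
    convˡ : ∀ f g h n → conv (f * g) h n ≡ conv (conv f g) h n
    convˡ f g h n = conv-cong n (λ k _ → *-conv f g k) (λ _ _ → refl)

  *-commₛ : ∀ f g → f * g ≈ g * f
  *-commₛ f g = ptwise λ n → ≡.trans (*-conv f g n) (≡.trans (conv-comm f g n) (≡.sym (*-conv g f n)))

  *-assocₛ : ∀ f g h → (f * g) * h ≈ f * (g * h)
  *-assocₛ f g h = ptwise λ n → begin
    ((f * g) * h) n      ≡⟨ *-conv (f * g) h n ⟩
    conv (f * g) h n     ≡⟨ convˡ f g h n ⟩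
    conv (conv f g) h n  ≡⟨ conv-assoc f g h n ⟩
    conv f (conv g h) n  ≡⟨ conv-comm f (conv g h) n ⟩
    conv (conv g h) f n  ≡⟨ convˡ g h f n ⟨
    conv (g * h) f n     ≡⟨ conv-comm (g * h) f n ⟩
    conv f (g * h) n     ≡⟨ *-conv f (g * h) n ⟨
    (f * (g * h)) n      ∎
    where open ≡-Reasoning

  *-distribˡₛ : ∀ f g h → f * (g + h) ≈ f * g + f * h
  *-distribˡₛ f g h = ptwise λ n → begin
    (f * (g + h)) n                ≡⟨ *-conv f (g + h) n ⟩
    conv f (g + h) n               ≡⟨ conv-cong n (λ _ _ → refl) (λ k _ → +-def g h k) ⟩
    conv f (g +ₛ h) n              ≡⟨ conv-distribˡ f g h n ⟩
    conv f g n ⊕ conv f h n        ≡⟨ cong₂ _⊕_ (*-conv f g n) (*-conv f h n) ⟨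
    (f * g) n ⊕ (f * h) n          ≡⟨ +-def (f * g) (f * h) n ⟨
    (f * g + f * h) n              ∎
    where open ≡-Reasoning

  constₛ-* : ∀ c f n → (constₛ c * f) n ≡ c ⊗ f n
  constₛ-* c f n = ≡.trans (*-conv (constₛ c) f n) (conv-constˡ c f n)

  scaleₛ-def : ∀ c f → scaleₛ c f ≈ constₛ c * f
  scaleₛ-def c f = ptwise λ n → ≡.sym (constₛ-* c f n)

  private
    *-identityˡₛ : ∀ f → oneₛ * f ≈ f
    *-identityˡₛ f = ptwise λ n → ≡.trans (constₛ-* 1# f n) (A.*-identityˡ (f n))

    open IsEquivalence ≈-isEquivalence using () renaming (trans to ≈-trans)

  0ₛ : Series
  0ₛ _ = 0#

  0ₛ-* : ∀ f → 0ₛ * f ≈ 0ₛ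
  0ₛ-* f = ptwise λ n → ≡.trans (*-conv 0ₛ f n) (conv-zeroˡ f n)

  -- Signs live in the coefficients, not in the series: 1 - x q^e is `binomial (⊖ x) e`, and
  -- cancellation goes through `mono-inverse`. The semiring solver then covers all rearrangements of
  -- products.
  series : CommutativeSemiring 0ℓ 0ℓ
  series = record
    { Carrier = Series ; _≈_ = _≈_ ; _+_ = _+_ ; _*_ = _*_ ; 0# = 0ₛ ; 1# = oneₛ
    ; isCommutativeSemiring = record
      { isSemiring = record
        { isSemiringWithoutAnnihilatingZero = record
          { +-isCommutativeMonoid = record
            { isMonoid = record
              { isSemigroup = record
                { isMagma = record
                  { isEquivalence = ≈-isEquivalence
                  ; ∙-cong = λ e e′ → ≈[]⇒≈ λ _ → +-cong[] (≈⇒≈[] e) (≈⇒≈[] e′)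
                  }
                ; assoc = +-assocₛ
                }
              ; identity = (λ f → ptwise λ n → ≡.trans (+-def 0ₛ f n) (A.+-identityˡ (f n)))
                         , (λ f → ptwise λ n → ≡.trans (+-def f 0ₛ n) (A.+-identityʳ (f n)))
              }
            ; comm = λ f g → ptwise λ n →
                ≡.trans (+-def f g n) (≡.trans (A.+-comm (f n) (g n)) (≡.sym (+-def g f n)))
            }
          ; *-cong = λ e e′ → ≈[]⇒≈ λ _ → *-cong[] (≈⇒≈[] e) (≈⇒≈[] e′)
          ; *-assoc = *-assocₛ
          ; *-identity = *-identityˡₛ , λ f → ≈-trans (*-commₛ f oneₛ) (*-identityˡₛ f)
          ; distrib = *-distribˡₛ , λ f g h → ≈-trans (*-commₛ (g + h) f) (≈-trans (*-distribˡₛ f g h)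
              (≈[]⇒≈ λ _ → +-cong[] (≈⇒≈[] (*-commₛ f g)) (≈⇒≈[] (*-commₛ f h))))
          }
        ; zero = 0ₛ-* , λ f → ≈-trans (*-commₛ f 0ₛ) (0ₛ-* f)
        }
      ; *-comm = *-commₛ
      }
    }
    where
    opaque
      unfolding _+_
      +-assocₛ : ∀ f g h → (f + g) + h ≈ f + (g + h)
      +-assocₛ f g h = ptwise λ n → A.+-assoc (f n) (g n) (h n)

  module S = CommutativeSemiring series
  open CommutativeSemigroupProperties S.*-commutativeSemigroup public using () renaming (interchange to *-interchange)

  -- Not refl: ⌊_⌋ is stuck on the open terms, although the underlying boolean tests agree.
  mono-suc : ∀ c e n → mono c (suc e) (suc n) ≡ mono c e n
  mono-suc c e n rewrite isYes≗does (suc n ℕ.≟ suc e) | isYes≗does (n ℕ.≟ e) = refl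

  mono-0 : ∀ c → mono c 0 ≈ constₛ c
  mono-0 c = ptwise λ { zero → refl ; (suc _) → refl }

  mono-< : ∀ c {e n} → n < e → mono c e n ≡ 0#
  mono-< c {suc e} {zero}  _         = refl
  mono-< c {suc e} {suc n} (s≤s n<e) = ≡.trans (mono-suc c e n) (mono-< c n<e)

  mono-≈[]-0 : ∀ c {e n} → n < e → mono c e ≈[ n ] 0ₛ
  mono-≈[]-0 c {e} n<e = ptwise λ k k≤n → mono-< c {e} (ℕ.≤-<-trans k≤n n<e)

  mono-*-< : ∀ c f {e n} → n < e → (mono c e * f) n ≡ 0#
  mono-*-< c f {e} {n} n<e = ≡.trans
    (below (*-cong[] {f = mono c e} (mono-≈[]-0 c n<e) ≈[].refl) n ℕ.≤-refl) (at (0ₛ-* f) n)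

  private
    conv-mono-suc : ∀ c e f n → conv (mono c (suc e) ∘ suc) f n ≡ conv (mono c e) f n
    conv-mono-suc c e f n = conv-cong n (λ k _ → mono-suc c e k) (λ _ _ → refl)

    conv-mono : ∀ c e f n → conv (mono c e) f (e ℕ.+ n) ≡ c ⊗ f n
    conv-mono c zero    f n = ≡.trans (conv-cong n (λ k _ → at (mono-0 c) k) (λ _ _ → refl)) (conv-constˡ c f n)
    conv-mono c (suc e) f n = ≡.trans
      (cong₂ _⊕_ (A.zeroˡ _) (≡.trans (conv-mono-suc c e f (e ℕ.+ n)) (conv-mono c e f n))) (A.+-identityˡ _)

    conv-mono-mono : ∀ c e d e′ n → conv (mono c e) (mono d e′) n ≡ mono (c ⊗ d) (e ℕ.+ e′) n
    conv-mono-mono c zero    d e′ n = ≡.trans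
      (≡.trans (conv-cong n (λ k _ → at (mono-0 c) k) (λ _ _ → refl)) (conv-constˡ c (mono d e′) n))
      (lemma n e′)
      where
      lemma : ∀ n e′ → c ⊗ mono d e′ n ≡ mono (c ⊗ d) e′ n
      lemma zero    zero     = refl
      lemma zero    (suc e′) = A.zeroʳ c
      lemma (suc n) zero     = A.zeroʳ c
      lemma (suc n) (suc e′) = ≡.trans (cong (c ⊗_) (mono-suc d e′ n))
                              (≡.trans (lemma n e′) (≡.sym (mono-suc (c ⊗ d) e′ n)))
    conv-mono-mono c (suc e) d e′ zero    = A.zeroˡ _
    conv-mono-mono c (suc e) d e′ (suc n) = ≡.trans
      (cong₂ _⊕_ (A.zeroˡ _) (≡.trans (conv-mono-suc c e (mono d e′) n) (conv-mono-mono c e d e′ n)))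
      (≡.trans (A.+-identityˡ _) (≡.sym (mono-suc (c ⊗ d) (e ℕ.+ e′) n)))

  mono-*-+ : ∀ c e f n → (mono c e * f) (e ℕ.+ n) ≡ c ⊗ f n
  mono-*-+ c e f n = ≡.trans (*-conv (mono c e) f (e ℕ.+ n)) (conv-mono c e f n)

  mono-* : ∀ c e d e′ → mono c e * mono d e′ ≈ mono (c ⊗ d) (e ℕ.+ e′)
  mono-* c e d e′ = ptwise λ n → ≡.trans (*-conv (mono c e) (mono d e′) n) (conv-mono-mono c e d e′ n)

  mono-inverse : ∀ c d e → c ⊕ d ≡ 0# → mono c e + mono d e ≈ 0ₛ
  mono-inverse c d e c+d≡0 = ptwise λ n → ≡.trans (+-def _ _ n) (lemma n e)
    where
    lemma : ∀ n e → mono c e n ⊕ mono d e n ≡ 0#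
    lemma zero    zero    = c+d≡0
    lemma zero    (suc e) = A.+-identityˡ 0#
    lemma (suc n) zero    = A.+-identityˡ 0#
    lemma (suc n) (suc e) = ≡.trans (cong₂ _⊕_ (mono-suc c e n) (mono-suc d e n)) (lemma n e)

  binomial : A → ℕ → Series
  binomial c e = oneₛ + mono c e

  geom-step : ∀ x e n → geom x e (suc e ℕ.+ n) ≡ x ⊗ geom x e n
  geom-step x e n = begin
    value ((suc e ℕ.+ n) ℕ.% suc e) ((suc e ℕ.+ n) ℕ./ suc e)
      ≡⟨ cong₂ value (≡.trans (cong (ℕ._% suc e) (ℕ.+-comm (suc e) n)) ([m+n]%n≡m%n n (suc e)))
                     (≡.trans (+-distrib-/-∣ˡ n (∣-refl {suc e})) (cong (ℕ._+ (n ℕ./ suc e)) (n/n≡1 (suc e)))) ⟩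
    value (n ℕ.% suc e) (suc (n ℕ./ suc e))
      ≡⟨ value-suc (n ℕ.% suc e) (n ℕ./ suc e) ⟩
    x ⊗ value (n ℕ.% suc e) (n ℕ./ suc e) ∎
    where
    open ≡-Reasoning
    value : ℕ → ℕ → A
    value r k = if ⌊ r ℕ.≟ 0 ⌋ then powA x k else 0#
    value-suc : ∀ r k → value r (suc k) ≡ x ⊗ value r k
    value-suc zero    k = refl
    value-suc (suc r) k = ≡.sym (A.zeroʳ x)

  geom-< : ∀ x e n → n < e → geom x e (suc n) ≡ 0#
  geom-< x e n n<e rewrite m<n⇒m%n≡m (s≤s n<e) = refl

  -- In degrees up to e the product has the coefficients of 1; from e + 1 on, `geom-step` turns the
  -- two contributions into x g and -x g.
  geom-inverse : ∀ x e → geom x e * binomial (⊖ x) (suc e) ≈ oneₛ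
  geom-inverse x e = ptwise λ n → begin
    (geom x e * binomial (⊖ x) (suc e)) n                ≡⟨ at (S.*-comm (geom x e) _) n ⟩
    (binomial (⊖ x) (suc e) * geom x e) n                ≡⟨ at (S.distribʳ (geom x e) oneₛ (mono (⊖ x) (suc e))) n ⟩
    (oneₛ * geom x e + mono (⊖ x) (suc e) * geom x e) n  ≡⟨ +-def _ _ n ⟩
    (oneₛ * geom x e) n ⊕ (mono (⊖ x) (suc e) * geom x e) n
      ≡⟨ cong (_⊕ (mono (⊖ x) (suc e) * geom x e) n) (at (S.*-identityˡ (geom x e)) n) ⟩
    geom x e n ⊕ (mono (⊖ x) (suc e) * geom x e) n       ≡⟨ telescope n ⟩
    oneₛ n                                               ∎
    where
    open ≡-Reasoning
    telescope : ∀ n → geom x e n ⊕ (mono (⊖ x) (suc e) * geom x e) n ≡ oneₛ n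
    telescope n with n ℕ.<? suc e
    telescope zero    | yes 0<e = ≡.trans (cong (1# ⊕_) (mono-*-< (⊖ x) (geom x e) 0<e)) (A.+-identityʳ 1#)
    telescope (suc n) | yes (s≤s n<e) =
      ≡.trans (cong₂ _⊕_ (geom-< x e n n<e) (mono-*-< (⊖ x) (geom x e) (s≤s n<e))) (A.+-identityˡ 0#)
    telescope n       | no n≮e with ℕ.m≤n⇒∃[o]m+o≡n (ℕ.≮⇒≥ n≮e)
    ... | k , refl = begin
      geom x e (suc e ℕ.+ k) ⊕ (mono (⊖ x) (suc e) * geom x e) (suc e ℕ.+ k)
        ≡⟨ cong₂ _⊕_ (geom-step x e k) (mono-*-+ (⊖ x) (suc e) (geom x e) k) ⟩
      (x ⊗ geom x e k) ⊕ ((⊖ x) ⊗ geom x e k)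
        ≡⟨ A.distribʳ (geom x e k) x (⊖ x) ⟨
      (x ⊕ (⊖ x)) ⊗ geom x e k
        ≡⟨ cong (_⊗ geom x e k) (A.-‿inverseʳ x) ⟩
      0# ⊗ geom x e k
        ≡⟨ A.zeroˡ _ ⟩
      0# ∎

  geom-≈[]-1 : ∀ x e {n} → n ≤ e → geom x e ≈[ n ] oneₛ
  geom-≈[]-1 x e n≤e = ptwise λ
    { zero    _   → refl
    ; (suc k) k<n → geom-< x e k (ℕ.<-≤-trans k<n n≤e) }

  binomial-≈[]-1 : ∀ c e {n} → n < e → binomial c e ≈[ n ] oneₛ
  binomial-≈[]-1 c e n<e =
    ≈[].trans (+-cong[] {f = oneₛ} ≈[].refl (mono-≈[]-0 c n<e)) (≈⇒≈[] (S.+-identityʳ oneₛ))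

  opaque
    unfolding _*_
    prodUpTo-suc : ∀ F k → prodUpTo F (suc k) ≈ prodUpTo F k * F (suc k)
    prodUpTo-suc F k = ptwise λ _ → refl

  -- The condition under which infProd is the q-adic limit of its partial products.
  Convergent : (ℕ → Series) → Set
  Convergent F = ∀ i → F (suc i) ≈[ i ] oneₛ

  prodUpTo-stable : ∀ {F} → Convergent F → ∀ n d → prodUpTo F (d ℕ.+ n) ≈[ n ] prodUpTo F n
  prodUpTo-stable conv n zero    = ≈[].refl
  prodUpTo-stable {F} conv n (suc d) = begin
    prodUpTo F (suc d ℕ.+ n)                   ≈⟨ ≈⇒≈[] (prodUpTo-suc F (d ℕ.+ n)) ⟩
    prodUpTo F (d ℕ.+ n) * F (suc (d ℕ.+ n))
      ≈⟨ *-cong[] (prodUpTo-stable {F} conv n d) (≈[]-weaken (ℕ.m≤n+m n d) (conv (d ℕ.+ n))) ⟩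
    prodUpTo F n * oneₛ                        ≈⟨ ≈⇒≈[] (S.*-identityʳ (prodUpTo F n)) ⟩
    prodUpTo F n                               ∎
    where open SetoidReasoning (≈[]-setoid n)

  -- `infProd` uses a different partial product for every coefficient. Stability lets one partial
  -- product serve all coefficients up to n.
  infProd-≈[] : ∀ {F} → Convergent F → ∀ {n N} → n ≤ N → infProd F ≈[ n ] prodUpTo F N
  infProd-≈[] {F} conv {n} {N} n≤N = ptwise λ k k≤n → case ℕ.m≤n⇒∃[o]m+o≡n (ℕ.≤-trans k≤n n≤N) of λ
    { (d , refl) → ≡.sym (≡.trans (cong (λ N → prodUpTo F N k) (ℕ.+-comm k d))
                                  (below (prodUpTo-stable {F} conv k d) k ℕ.≤-refl)) }

  prodUpTo-cong : ∀ {F G} → (∀ i → F i ≈ G i) → ∀ n → prodUpTo F n ≈ prodUpTo G n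
  prodUpTo-cong F≈G zero    = F≈G 0
  prodUpTo-cong {F} {G} F≈G (suc n) =
    S.trans (prodUpTo-suc F n) (S.trans (S.*-cong (prodUpTo-cong F≈G n) (F≈G (suc n))) (S.sym (prodUpTo-suc G n)))

  infProd-cong : ∀ {F G} → (∀ i → F i ≈ G i) → infProd F ≈ infProd G
  infProd-cong F≈G = ptwise λ n → at (prodUpTo-cong F≈G n) n

  infProd-1 : ∀ {F} → (∀ i → F i ≈ oneₛ) → infProd F ≈ oneₛ
  infProd-1 F≈1 = ptwise λ n → at (prodUpTo-1 n) n
    where
    prodUpTo-1 : ∀ n → prodUpTo _ n ≈ oneₛ
    prodUpTo-1 zero    = F≈1 0
    prodUpTo-1 (suc n) =
      S.trans (prodUpTo-suc _ n) (S.trans (S.*-cong (prodUpTo-1 n) (F≈1 (suc n))) (S.*-identityˡ oneₛ))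

  infProd-* : ∀ {F G} → Convergent F → Convergent G → infProd F * infProd G ≈ infProd (λ i → F i * G i)
  infProd-* {F} {G} convF convG = ptwise λ n → begin
    (infProd F * infProd G) n
      ≡⟨ below (*-cong[] (infProd-≈[] {F} convF ℕ.≤-refl) (infProd-≈[] {G} convG ℕ.≤-refl)) n ℕ.≤-refl ⟩
    (prodUpTo F n * prodUpTo G n) n  ≡⟨ at (prodUpTo-* n) n ⟩
    infProd (λ i → F i * G i) n      ∎
    where
    open ≡-Reasoning
    prodUpTo-* : ∀ n → prodUpTo F n * prodUpTo G n ≈ prodUpTo (λ i → F i * G i) n
    prodUpTo-* zero    = S.refl
    prodUpTo-* (suc n) =
      S.trans (S.*-cong (prodUpTo-suc F n) (prodUpTo-suc G n))
      (S.trans (*-interchange _ _ _ _)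
      (S.trans (S.*-congʳ (prodUpTo-* n)) (S.sym (prodUpTo-suc _ n))))

  -- The partial product up to index 2n + 1 contains equally many even and odd factors, so it pairs
  -- off exactly; by convergence it has the same coefficient at q^n as the product up to n.
  infProd-dissect : ∀ {F} → Convergent F → Convergent (λ i → F (double i)) → Convergent (λ i → F (suc (double i))) →
                    infProd F ≈ infProd (λ i → F (double i)) * infProd (λ i → F (suc (double i)))
  infProd-dissect {F} conv convₑ convₒ = S.trans
    (ptwise λ n → ≡.trans (below (infProd-≈[] {F} conv (ℕ.m≤n⇒m≤1+n (n≤double n))) n ℕ.≤-refl) (at (pairs n) n))
    (S.sym (infProd-* {λ i → F (double i)} {λ i → F (suc (double i))} convₑ convₒ))
    where
    pairs : ∀ n → prodUpTo F (suc (double n)) ≈ prodUpTo (λ i → F (double i) * F (suc (double i))) n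
    pairs zero    = prodUpTo-suc F 0
    pairs (suc n) = begin
      prodUpTo F (suc (double (suc n)))
        ≈⟨ S.trans (prodUpTo-suc F _) (S.*-congʳ (prodUpTo-suc F _)) ⟩
      (prodUpTo F (suc (double n)) * F (double (suc n))) * F (suc (double (suc n)))
        ≈⟨ S.*-assoc _ _ _ ⟩
      prodUpTo F (suc (double n)) * (F (double (suc n)) * F (suc (double (suc n))))
        ≈⟨ S.*-congʳ (pairs n) ⟩
      prodUpTo (λ i → F (double i) * F (suc (double i))) n * (F (double (suc n)) * F (suc (double (suc n))))
        ≈⟨ prodUpTo-suc _ n ⟨
      prodUpTo (λ i → F (double i) * F (suc (double i))) (suc n) ∎
      where open SetoidReasoning S.setoid

-- The Jacobi triple product and its 2-dissection

double≡ : ∀ n → double n ≡ n ℕ.+ n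
double≡ zero    = refl
double≡ (suc n) = cong suc (≡.trans (cong suc (double≡ n)) (≡.sym (ℕ.+-suc n n)))

-- expo a b m i N = m k(k-1)/2 + a k with k = i - N ∈ ℤ, when a + b = m.
expo : ℕ → ℕ → ℕ → ℕ → ℕ → ℕ
expo a b m zero    zero    = 0
expo a b m (suc i) zero    = (a ℕ.+ m ℕ.* i) ℕ.+ expo a b m i zero
expo a b m zero    (suc N) = (b ℕ.+ m ℕ.* N) ℕ.+ expo a b m zero N
expo a b m (suc i) (suc N) = expo a b m i N

-- For E(k) = m k(k-1)/2 + a k one has E(k) - E(k-1) = m(k-1) + a. Putting k = i - N and m - a = b
-- gives this subtraction-free form.
expo-shift : ∀ a b i N → let m = a ℕ.+ b in
             m ℕ.* i ℕ.+ expo a b m i (suc N) ≡ (b ℕ.+ m ℕ.* N) ℕ.+ expo a b m i N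
expo-shift a b zero    N       = cong (ℕ._+ ((b ℕ.+ (a ℕ.+ b) ℕ.* N) ℕ.+ expo a b (a ℕ.+ b) 0 N)) (ℕ.*-zeroʳ (a ℕ.+ b))
expo-shift a b (suc i) zero    = lemma (expo a b (a ℕ.+ b) i 0)
  where
  lemma : ∀ e → (a ℕ.+ b) ℕ.* suc i ℕ.+ e ≡ (b ℕ.+ (a ℕ.+ b) ℕ.* 0) ℕ.+ ((a ℕ.+ (a ℕ.+ b) ℕ.* i) ℕ.+ e)
  lemma e = ℕ-solve (a ∷ b ∷ i ∷ e ∷ [])
expo-shift a b (suc i) (suc N) = lemma (expo a b (a ℕ.+ b) i N) (expo a b (a ℕ.+ b) i (suc N)) (expo-shift a b i N)
  where
  lemma : ∀ e e′ → (a ℕ.+ b) ℕ.* i ℕ.+ e′ ≡ (b ℕ.+ (a ℕ.+ b) ℕ.* N) ℕ.+ e →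
          (a ℕ.+ b) ℕ.* suc i ℕ.+ e′ ≡ (b ℕ.+ (a ℕ.+ b) ℕ.* suc N) ℕ.+ e
  lemma e e′ eq = begin
    (a ℕ.+ b) ℕ.* suc i ℕ.+ e′                  ≡⟨ ℕ-solve (a ∷ b ∷ i ∷ e′ ∷ []) ⟩
    (a ℕ.+ b) ℕ.+ ((a ℕ.+ b) ℕ.* i ℕ.+ e′)      ≡⟨ cong ((a ℕ.+ b) ℕ.+_) eq ⟩
    (a ℕ.+ b) ℕ.+ ((b ℕ.+ (a ℕ.+ b) ℕ.* N) ℕ.+ e) ≡⟨ ℕ-solve (a ∷ b ∷ N ∷ e ∷ []) ⟩
    (b ℕ.+ (a ℕ.+ b) ℕ.* suc N) ℕ.+ e           ∎
    where open ≡-Reasoning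

-- At k = -(d+1) the exponent is a sum containing b + (m+1) d. Linear growth is enough to make all
-- terms far from the centre vanish modulo q^(n+1).
expo-left : ∀ a b m i d → d ≤ expo a b (suc m) i (i ℕ.+ suc d)
expo-left a b m zero    d = ℕ.≤-trans (ℕ.m≤m+n d (m ℕ.* d)) (ℕ.≤-trans (ℕ.m≤n+m _ b) (ℕ.m≤m+n _ _))
expo-left a b m (suc i) d = expo-left a b m i d

expo-right : ∀ a b m N d → d ≤ expo a b (suc m) (N ℕ.+ suc d) N
expo-right a b m zero    d = ℕ.≤-trans (ℕ.m≤m+n d (m ℕ.* d)) (ℕ.≤-trans (ℕ.m≤n+m _ a) (ℕ.m≤m+n _ _))
expo-right a b m (suc N) d = expo-right a b m N d

-- E(2k) = 4m k(k-1)/2 + (2a+m) k. As `double` adds two constructors at a time, the diagonal case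
-- reduces to the hypothesis.
expo-even : ∀ a b m i N → expo a b m (double i) (double N) ≡
                          expo (2 ℕ.* a ℕ.+ m) (2 ℕ.* b ℕ.+ m) (4 ℕ.* m) i N
expo-even a b m zero    zero    = refl
expo-even a b m (suc i) zero    rewrite double≡ i | ≡.sym (expo-even a b m i 0) | double≡ i =
  lemma (expo a b m (i ℕ.+ i) 0)
  where
  lemma : ∀ e → (a ℕ.+ m ℕ.* suc (i ℕ.+ i)) ℕ.+ ((a ℕ.+ m ℕ.* (i ℕ.+ i)) ℕ.+ e) ≡
                ((2 ℕ.* a ℕ.+ m) ℕ.+ (4 ℕ.* m) ℕ.* i) ℕ.+ e
  lemma e = ℕ-solve (a ∷ m ∷ i ∷ e ∷ [])
expo-even a b m zero    (suc N) rewrite double≡ N | ≡.sym (expo-even a b m 0 N) | double≡ N =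
  lemma (expo a b m 0 (N ℕ.+ N))
  where
  lemma : ∀ e → (b ℕ.+ m ℕ.* suc (N ℕ.+ N)) ℕ.+ ((b ℕ.+ m ℕ.* (N ℕ.+ N)) ℕ.+ e) ≡
                ((2 ℕ.* b ℕ.+ m) ℕ.+ (4 ℕ.* m) ℕ.* N) ℕ.+ e
  lemma e = ℕ-solve (b ∷ m ∷ N ∷ e ∷ [])
expo-even a b m (suc i) (suc N) = expo-even a b m i N

-- E(2k+1) = a + 4m k(k-1)/2 + (2a+3m) k. The complementary parameter 4m - (2a+3m) equals b - a,
-- whence the parametrisation b = a + c.
expo-odd : ∀ a c i N → let b = a ℕ.+ c ; m = a ℕ.+ b in
           expo a b m (suc (double i)) (double N) ≡ a ℕ.+ expo (2 ℕ.* a ℕ.+ 3 ℕ.* m) c (4 ℕ.* m) i N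
expo-odd a c zero zero = lemma (a ℕ.+ (a ℕ.+ c))
  where
  lemma : ∀ m → (a ℕ.+ m ℕ.* 0) ℕ.+ 0 ≡ a ℕ.+ 0
  lemma m = ℕ-solve (a ∷ m ∷ [])
expo-odd a c (suc i) zero = step (a ℕ.+ (a ℕ.+ c)) (expo-odd a c i 0)
  where
  lemma : ∀ m e → (a ℕ.+ m ℕ.* suc (suc (i ℕ.+ i))) ℕ.+ ((a ℕ.+ m ℕ.* suc (i ℕ.+ i)) ℕ.+ (a ℕ.+ e)) ≡
                  a ℕ.+ (((2 ℕ.* a ℕ.+ 3 ℕ.* m) ℕ.+ (4 ℕ.* m) ℕ.* i) ℕ.+ e)
  lemma m e = ℕ-solve (a ∷ m ∷ i ∷ e ∷ [])
  step : ∀ m {e e′} → e ≡ a ℕ.+ e′ →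
         (a ℕ.+ m ℕ.* suc (suc (double i))) ℕ.+ ((a ℕ.+ m ℕ.* suc (double i)) ℕ.+ e) ≡
         a ℕ.+ (((2 ℕ.* a ℕ.+ 3 ℕ.* m) ℕ.+ (4 ℕ.* m) ℕ.* i) ℕ.+ e′)
  step m {e′ = e′} refl rewrite double≡ i = lemma m e′
-- On the negative side the odd indices 2k + 1 start at -1, a single step from the centre, so k = -1
-- is the base case here.
expo-odd a c zero (suc zero) = lemma
  where
  lemma : ((a ℕ.+ c) ℕ.+ (a ℕ.+ (a ℕ.+ c)) ℕ.* 0) ℕ.+ 0 ≡ a ℕ.+ ((c ℕ.+ 4 ℕ.* (a ℕ.+ (a ℕ.+ c)) ℕ.* 0) ℕ.+ 0)
  lemma = ℕ-solve (a ∷ c ∷ [])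
expo-odd a c zero (suc (suc N)) = step (expo-odd a c zero (suc N))
  where
  b m : ℕ
  b = a ℕ.+ c
  m = a ℕ.+ b
  lemma : ∀ e → (a ℕ.+ c ℕ.+ (a ℕ.+ (a ℕ.+ c)) ℕ.* suc (suc (N ℕ.+ N))) ℕ.+
                ((a ℕ.+ c ℕ.+ (a ℕ.+ (a ℕ.+ c)) ℕ.* suc (N ℕ.+ N)) ℕ.+ (a ℕ.+ e)) ≡
                a ℕ.+ ((c ℕ.+ 4 ℕ.* (a ℕ.+ (a ℕ.+ c)) ℕ.* suc N) ℕ.+ e)
  lemma e = ℕ-solve (a ∷ c ∷ N ∷ e ∷ [])
  step : ∀ {e e′} → e ≡ a ℕ.+ e′ →
         (b ℕ.+ m ℕ.* suc (suc (double N))) ℕ.+ ((b ℕ.+ m ℕ.* suc (double N)) ℕ.+ e) ≡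
         a ℕ.+ ((c ℕ.+ 4 ℕ.* m ℕ.* suc N) ℕ.+ e′)
  step {e′ = e′} refl rewrite double≡ N = lemma e′
expo-odd a c (suc i) (suc N) = expo-odd a c i N

module JacobiTriple {A : Set} {_⊕_ _⊗_ : A → A → A} {⊖_ : A → A} {0# 1# : A}
                    (isCR : IsCommutativeRing _≡_ _⊕_ _⊗_ ⊖_ 0# 1#) where

  open PowerSeries isCR
  open Antidiagonal series using ()
    renaming (antidiag to antidiagₛ; antidiag-cong to antidiagₛ-cong; antidiag-*ˡ to antidiagₛ-*ˡ;
              antidiag-snoc to antidiagₛ-snoc; antidiag-pascal to antidiagₛ-pascal)
  open SemiringSolver series using (_:+_; _:*_) renaming (solve to solveₛ)

  private
    module A where
      open CommutativeRing coefficients public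
      open RingProperties ring public

  -- Half-open variant of `prodUpTo`: it has an empty product, needed for (Q;Q)_0 = 1.
  partialProd : (ℕ → Series) → ℕ → Series
  partialProd F zero    = oneₛ
  partialProd F (suc n) = partialProd F n * F n

  prodUpTo-partialProd : ∀ F n → prodUpTo F n ≈ partialProd F (suc n)
  prodUpTo-partialProd F zero    = S.sym (S.*-identityˡ (F 0))
  prodUpTo-partialProd F (suc n) = S.trans (prodUpTo-suc F n) (S.*-congʳ (prodUpTo-partialProd F n))

  partialProd-inverse : ∀ {F G} → (∀ i → G i * F i ≈ oneₛ) → ∀ n → partialProd G n * partialProd F n ≈ oneₛ
  partialProd-inverse         inv zero    = S.*-identityˡ oneₛ
  partialProd-inverse {F} {G} inv (suc n) = S.trans (*-interchange _ _ _ _)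
    (S.trans (S.*-cong (partialProd-inverse {F} {G} inv n) (inv n)) (S.*-identityˡ oneₛ))

  infProd-partialProd : ∀ {F} → Convergent F → ∀ {n N} → n < N → infProd F ≈[ n ] partialProd F N
  infProd-partialProd {F} conv {N = suc N} (s≤s n≤N) =
    ≈[].trans (infProd-≈[] {F} conv n≤N) (≈⇒≈[] (prodUpTo-partialProd F N))

  factors : A → ℕ → ℕ → ℕ → Series
  factors c a m i = binomial c (a ℕ.+ m ℕ.* i)

  factors-convergent : ∀ c a m → Convergent (factors c a (suc m))
  factors-convergent c a m i = binomial-≈[]-1 c _ (ℕ.≤-trans (ℕ.m≤m+n (suc i) (m ℕ.* suc i)) (ℕ.m≤n+m _ a))

  poch-factors : ∀ c a m → poch c a m ≈ infProd (factors (⊖ c) a m)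
  poch-factors c a m = infProd-cong λ i → +ₛ-def oneₛ (mono (⊖ c) (a ℕ.+ m ℕ.* i))

  mono-≡ : ∀ {c d e f} → c ≡ d → e ≡ f → mono c e ≈ mono d f
  mono-≡ refl refl = S.refl

  module GaussBinomial (m : ℕ) where

    -- With Q = q^(1+m): (Q;Q)_n, its inverse, and the Gaussian binomial [i+j choose i] at Q.
    [Q]_ [Q]⁻¹_ : ℕ → Series
    [Q]_   = partialProd (factors (⊖ 1#) (suc m) (suc m))
    [Q]⁻¹_ = partialProd (λ i → geom 1# (m ℕ.+ suc m ℕ.* i))

    gauss : ℕ → ℕ → Series
    gauss i j = [Q] (i ℕ.+ j) * ([Q]⁻¹ i * [Q]⁻¹ j)

    -- Off by one: this is Q^(i+1), the power in the last factor of `[Q] (suc i)`.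
    Q^ : ℕ → Series
    Q^ i = mono 1# (suc m ℕ.+ suc m ℕ.* i)

    [Q]-inverse : ∀ n → [Q]⁻¹ n * [Q] n ≈ oneₛ
    [Q]-inverse = partialProd-inverse (λ i → geom-inverse 1# (m ℕ.+ suc m ℕ.* i))

    private
      1-Q^ : ℕ → Series
      1-Q^ = factors (⊖ 1#) (suc m) (suc m)

      -- 1 - Q^(x+y) = (1 - Q^x) + Q^x (1 - Q^y) for x = i + 1, y = j + 1: the q-Pascal rule before
      -- division. Lacking subtraction, the proof inserts the cancelling pair -Q^x + Q^x.
      1-Q^-split : ∀ i j → 1-Q^ (i ℕ.+ suc j) ≈ 1-Q^ i + Q^ i * 1-Q^ j
      1-Q^-split i j = begin
        oneₛ + -Q (i ℕ.+ suc j)               ≈⟨ S.+-congˡ combine ⟨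
        oneₛ + Q^ i * -Q j                    ≈⟨ S.+-congˡ (S.+-identityˡ (Q^ i * -Q j)) ⟨
        oneₛ + (0ₛ + Q^ i * -Q j)
          ≈⟨ S.+-congˡ (S.+-congʳ (mono-inverse (⊖ 1#) 1# _ (A.-‿inverseˡ 1#))) ⟨
        oneₛ + ((-Q i + Q^ i) + Q^ i * -Q j)
          ≈⟨ solveₛ 4 (λ o a b c → o :+ ((a :+ b) :+ b :* c) , (o :+ a) :+ (b :+ b :* c)) S.refl oneₛ (-Q i) (Q^ i) (-Q j) ⟩
        1-Q^ i + (Q^ i + Q^ i * -Q j)
          ≈⟨ S.+-congˡ (S.+-congʳ (S.*-identityʳ (Q^ i))) ⟨
        1-Q^ i + (Q^ i * oneₛ + Q^ i * -Q j)
          ≈⟨ S.+-congˡ (S.distribˡ (Q^ i) oneₛ (-Q j)) ⟨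
        1-Q^ i + Q^ i * 1-Q^ j                ∎
        where
        open SetoidReasoning S.setoid
        -Q : ℕ → Series
        -Q i = mono (⊖ 1#) (suc m ℕ.+ suc m ℕ.* i)
        exponent : ∀ i j → (suc m ℕ.+ suc m ℕ.* i) ℕ.+ (suc m ℕ.+ suc m ℕ.* j) ≡ suc m ℕ.+ suc m ℕ.* (i ℕ.+ suc j)
        exponent i j = ℕ-solve (m ∷ i ∷ j ∷ [])
        combine : Q^ i * -Q j ≈ -Q (i ℕ.+ suc j)
        combine = S.trans (mono-* 1# (suc m ℕ.+ suc m ℕ.* i) (⊖ 1#) (suc m ℕ.+ suc m ℕ.* j)) (mono-≡ (A.*-identityˡ _) (exponent i j))

      [Q]⁻¹-suc : ∀ i → [Q]⁻¹ suc i * 1-Q^ i ≈ [Q]⁻¹ i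
      [Q]⁻¹-suc i = S.trans (S.*-assoc _ _ _)
        (S.trans (S.*-congˡ (geom-inverse 1# (m ℕ.+ suc m ℕ.* i))) (S.*-identityʳ _))

    gauss-comm : ∀ i j → gauss i j ≈ gauss j i
    gauss-comm i j = S.*-cong (S.reflexive (cong [Q]_ (ℕ.+-comm i j))) (S.*-comm _ _)

    gauss-0 : ∀ j → gauss 0 j ≈ oneₛ
    gauss-0 j = S.trans (S.*-congˡ (S.*-identityˡ _)) (S.trans (S.*-comm _ _) ([Q]-inverse j))

    -- The last factor of (Q;Q)_(i+j+2) is split in two; each half cancels the last factor of one of
    -- the two inverses.
    gauss-pascalˡ : ∀ i j → gauss (suc i) (suc j) ≈ gauss i (suc j) + Q^ i * gauss (suc i) j
    gauss-pascalˡ i j = begin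
      (P * 1-Q^ (i ℕ.+ suc j)) * (x * y)
        ≈⟨ S.*-congʳ (S.*-congˡ (1-Q^-split i j)) ⟩
      (P * (1-Q^ i + Q^ i * 1-Q^ j)) * (x * y)
        ≈⟨ solveₛ 6 (λ p u w v x y → (p :* (u :+ w :* v)) :* (x :* y) ,
                                     p :* ((x :* u) :* y) :+ w :* (p :* (x :* (y :* v)))) S.refl
             P (1-Q^ i) (Q^ i) (1-Q^ j) x y ⟩
      P * ((x * 1-Q^ i) * y) + Q^ i * (P * (x * (y * 1-Q^ j)))
        ≈⟨ S.+-cong (S.*-congˡ (S.*-congʳ ([Q]⁻¹-suc i)))
                    (S.*-congˡ (S.*-cong (S.reflexive (cong [Q]_ (ℕ.+-suc i j))) (S.*-congˡ ([Q]⁻¹-suc j)))) ⟩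
      gauss i (suc j) + Q^ i * gauss (suc i) j ∎
      where
      open SetoidReasoning S.setoid
      P x y : Series
      P = [Q] (i ℕ.+ suc j)
      x = [Q]⁻¹ suc i
      y = [Q]⁻¹ suc j

    -- Symmetry moves the power of Q to the other summand. This form serves to append a factor on
    -- the a-side, the other one on the b-side.
    gauss-pascalʳ : ∀ i j → gauss (suc i) (suc j) ≈ Q^ j * gauss i (suc j) + gauss (suc i) j
    gauss-pascalʳ i j = begin
      gauss (suc i) (suc j)                     ≈⟨ gauss-comm (suc i) (suc j) ⟩
      gauss (suc j) (suc i)                     ≈⟨ gauss-pascalˡ j i ⟩
      gauss j (suc i) + Q^ j * gauss (suc j) i  ≈⟨ S.+-comm _ _ ⟩
      Q^ j * gauss (suc j) i + gauss j (suc i)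
        ≈⟨ S.+-cong (S.*-congˡ (gauss-comm (suc j) i)) (gauss-comm j (suc i)) ⟩
      Q^ j * gauss i (suc j) + gauss (suc i) j  ∎
      where open SetoidReasoning S.setoid

    -- All (Q;Q)_k with k > n agree modulo q^(n+1), also with (Q;Q)_∞. So the numerator may be
    -- traded for `[Q] i` and the infinite product for `[Q] j`, and both cancel.
    gauss-limit : ∀ {n i j} → n < i → n < j → gauss i j * poch 1# (suc m) (suc m) ≈[ n ] oneₛ
    gauss-limit {n} {i} {j} n<i n<j = begin
      ([Q] (i ℕ.+ j) * ([Q]⁻¹ i * [Q]⁻¹ j)) * poch 1# (suc m) (suc m)
        ≈⟨ *-cong[] (*-cong[] {f′ = [Q] i} (≈[].trans (≈[].sym (limit (ℕ.≤-trans n<i (ℕ.m≤m+n i j)))) (limit n<i)) ≈[].refl) (limit n<j) ⟩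
      ([Q] i * ([Q]⁻¹ i * [Q]⁻¹ j)) * [Q] j
        ≈⟨ ≈⇒≈[] (solveₛ 4 (λ a b c d → (a :* (b :* c)) :* d , (b :* a) :* (c :* d)) S.refl
                  ([Q] i) ([Q]⁻¹ i) ([Q]⁻¹ j) ([Q] j)) ⟩
      ([Q]⁻¹ i * [Q] i) * ([Q]⁻¹ j * [Q] j)
        ≈⟨ ≈⇒≈[] (S.trans (S.*-cong ([Q]-inverse i) ([Q]-inverse j)) (S.*-identityˡ oneₛ)) ⟩
      oneₛ ∎
      where
      open SetoidReasoning (≈[]-setoid n)
      limit : ∀ {k} → n < k → poch 1# (suc m) (suc m) ≈[ n ] [Q] k
      limit n<k = ≈[].trans (≈⇒≈[] (poch-factors 1# (suc m) (suc m)))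
                            (infProd-partialProd {factors (⊖ 1#) (suc m) (suc m)} (factors-convergent (⊖ 1#) (suc m) m) n<k)

  antidiagₛ-cong[] : ∀ {f g n} N → (∀ i j → i ℕ.+ j ≡ N → f i j ≈[ n ] g i j) → antidiagₛ f N ≈[ n ] antidiagₛ g N
  antidiagₛ-cong[] zero    f≈g = f≈g 0 0 refl
  antidiagₛ-cong[] (suc N) f≈g =
    +-cong[] (f≈g 0 (suc N) refl) (antidiagₛ-cong[] N λ i j e → f≈g (suc i) j (cong suc e))

  total : (ℕ → Series) → ℕ → Series
  total f = antidiagₛ (λ i _ → f i)

  total-parity : ∀ f n → total f (suc (double n)) ≈ total (f ∘ double) n + total (f ∘ suc ∘ double) n
  total-parity f zero    = S.refl
  total-parity f (suc n) = S.trans (S.+-congˡ (S.+-congˡ (total-parity (f ∘ suc ∘ suc) n)))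
    (solveₛ 4 (λ x y u v → x :+ (y :+ (u :+ v)) , (x :+ u) :+ (y :+ v)) S.refl _ _ _ _)

  -- For a + b = m and c² = 1 this is j(c q^a; q^m), since q^m / (c q^a) = c q^b.
  theta : A → ℕ → ℕ → ℕ → Series
  theta c a b m = (poch c a m * poch c b m) * poch 1# m m

  -- s^k for k = i - N, using s^(-1) = s; the recursion mirrors that of `expo`.
  sign : A → ℕ → ℕ → A
  sign s zero    zero    = 1#
  sign s (suc i) zero    = s ⊗ sign s i zero
  sign s zero    (suc N) = s ⊗ sign s zero N
  sign s (suc i) (suc N) = sign s i N

  thetaTerm : A → ℕ → ℕ → ℕ → ℕ → ℕ → Series
  thetaTerm s a b m i N = mono (sign s i N) (expo a b m i N)

  module _ {s : A} (s²≡1 : s ⊗ s ≡ 1#) where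

    private
      s*s* : ∀ x → s ⊗ (s ⊗ x) ≡ x
      s*s* x = ≡.trans (≡.sym (A.*-assoc s s x)) (≡.trans (cong (_⊗ x) s²≡1) (A.*-identityˡ x))

    sign-shift : ∀ i N → sign s i (suc N) ≡ s ⊗ sign s i N
    sign-shift zero    N       = refl
    sign-shift (suc i) zero    = ≡.sym (s*s* (sign s i 0))
    sign-shift (suc i) (suc N) = sign-shift i N

    -- s^(2k) = 1, written as `sign 1#` so that the even part is again a `thetaTerm`.
    sign-even : ∀ i N → sign s (double i) (double N) ≡ sign 1# i N
    sign-even zero    zero    = refl
    sign-even (suc i) zero    = ≡.trans (s*s* _) (≡.trans (sign-even i 0) (≡.sym (A.*-identityˡ _)))
    sign-even zero    (suc N) = ≡.trans (s*s* _) (≡.trans (sign-even 0 N) (≡.sym (A.*-identityˡ _)))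
    sign-even (suc i) (suc N) = sign-even i N

    sign-odd : ∀ i N → sign s (suc (double i)) (double N) ≡ s ⊗ sign 1# i N
    sign-odd i       zero    = cong (s ⊗_) (sign-even i 0)
    sign-odd zero    (suc N) = ≡.trans (≡.sym (s*s* _))
      (cong (s ⊗_) (≡.trans (sign-even 0 (suc N)) refl))
    sign-odd (suc i) (suc N) = sign-odd i N

    term-shift : ∀ a b i N → let m = a ℕ.+ b in
                 mono 1# (m ℕ.* i) * thetaTerm s a b m i (suc N) ≈ mono s (b ℕ.+ m ℕ.* N) * thetaTerm s a b m i N
    term-shift a b i N = S.trans (mono-* 1# _ _ (expo a b _ i (suc N)))
      (S.trans (mono-≡ (≡.trans (A.*-identityˡ _) (sign-shift i N)) (expo-shift a b i N))
               (S.sym (mono-* s _ _ (expo a b _ i N))))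

    module _ (a b m : ℕ) (a+b≡1+m : a ℕ.+ b ≡ suc m) where

      open GaussBinomial m

      private
        term : ℕ → ℕ → Series
        term = thetaTerm s a b (suc m)

        term-suc-0 : ∀ i → mono s (a ℕ.+ suc m ℕ.* i) * term i 0 ≈ term (suc i) 0
        term-suc-0 i = mono-* s (a ℕ.+ suc m ℕ.* i) (sign s i 0) (expo a b (suc m) i 0)

        term-0-suc : ∀ N → mono s (b ℕ.+ suc m ℕ.* N) * term 0 N ≈ term 0 (suc N)
        term-0-suc N = mono-* s (b ℕ.+ suc m ℕ.* N) (sign s 0 N) (expo a b (suc m) 0 N)

        -- `term (suc i) (suc N)` reduces to `term i N`, so `term-shift` at `suc i` converts the
        -- power of Q from the q-Pascal rule into the monomial of the new b-factor, at the price of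
        -- moving k to k + 1.
        Q^-term : ∀ i N → Q^ i * term i N ≈ mono s (b ℕ.+ suc m ℕ.* N) * term (suc i) N
        Q^-term i N = S.trans (S.*-congʳ (mono-≡ refl (≡.sym (ℕ.*-suc (suc m) i))))
          (≡.subst (λ m → mono 1# (m ℕ.* suc i) * thetaTerm s a b m i N ≈
                          mono s (b ℕ.+ m ℕ.* N) * thetaTerm s a b m (suc i) N) a+b≡1+m (term-shift a b (suc i) N))

      -- The sum runs over i + j = N + M; the bilateral summation index is i - N.
      finiteTheta : ℕ → ℕ → Series
      finiteTheta N M = antidiagₛ (λ i j → gauss i j * term i N) (N ℕ.+ M)

      finiteTheta-0-0 : finiteTheta 0 0 ≈ oneₛ
      finiteTheta-0-0 = S.trans (S.*-cong (gauss-0 0) (mono-0 1#)) (S.*-identityˡ oneₛ)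

      -- The induction step of the q-binomial theorem. Q^(j+1) from the Pascal rule times s q^(a+mi)
      -- from the ratio of terms depends only on i + j + 1 = M, so it factors out of the sum.
      finiteTheta-0-suc : ∀ M → finiteTheta 0 (suc M) ≈ finiteTheta 0 M * factors s a (suc m) M
      finiteTheta-0-suc M = begin
        finiteTheta 0 (suc M)
          ≈⟨ antidiagₛ-pascal (λ i j → gauss i j * term i 0) (λ i j → c * (gauss i j * term i 0))
               (λ i j → gauss i j * term i 0) M first last inner ⟩
        antidiagₛ (λ i j → c * (gauss i j * term i 0)) M + finiteTheta 0 M
          ≈⟨ S.+-congʳ (antidiagₛ-*ˡ c _ M) ⟩
        c * finiteTheta 0 M + finiteTheta 0 M
          ≈⟨ S.+-congˡ (S.*-identityˡ _) ⟨
        c * finiteTheta 0 M + oneₛ * finiteTheta 0 M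
          ≈⟨ solveₛ 3 (λ c o t → c :* t :+ o :* t , t :* (o :+ c)) S.refl c oneₛ (finiteTheta 0 M) ⟩
        finiteTheta 0 M * (oneₛ + c) ∎
        where
        open SetoidReasoning S.setoid
        c : Series
        c = mono s (a ℕ.+ suc m ℕ.* M)
        first : gauss 0 (suc M) * term 0 0 ≈ gauss 0 M * term 0 0
        first = S.*-congʳ (S.trans (gauss-0 (suc M)) (S.sym (gauss-0 M)))
        last : gauss (suc M) 0 * term (suc M) 0 ≈ c * (gauss M 0 * term M 0)
        last = begin
          gauss (suc M) 0 * term (suc M) 0
            ≈⟨ S.*-cong (S.trans (gauss-comm (suc M) 0) (S.trans (gauss-0 (suc M))
                        (S.sym (S.trans (gauss-comm M 0) (gauss-0 M))))) (S.sym (term-suc-0 M)) ⟩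
          gauss M 0 * (c * term M 0)
            ≈⟨ solveₛ 3 (λ g c t → g :* (c :* t) , c :* (g :* t)) S.refl (gauss M 0) c (term M 0) ⟩
          c * (gauss M 0 * term M 0) ∎
        Q^-c : ∀ i j → suc i ℕ.+ j ≡ M → Q^ j * mono s (a ℕ.+ suc m ℕ.* i) ≈ c
        Q^-c i j refl = S.trans (mono-* 1# (suc m ℕ.+ suc m ℕ.* j) s _) (mono-≡ (A.*-identityˡ s) exponent)
          where
          exponent : (suc m ℕ.+ suc m ℕ.* j) ℕ.+ (a ℕ.+ suc m ℕ.* i) ≡ a ℕ.+ suc m ℕ.* (suc i ℕ.+ j)
          exponent = ℕ-solve (m ∷ a ∷ i ∷ j ∷ [])
        inner : ∀ i j → suc i ℕ.+ j ≡ M →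
                gauss (suc i) (suc j) * term (suc i) 0 ≈
                c * (gauss i (suc j) * term i 0) + gauss (suc i) j * term (suc i) 0
        inner i j e = begin
          gauss (suc i) (suc j) * term (suc i) 0
            ≈⟨ S.trans (S.*-congʳ (gauss-pascalʳ i j)) (S.distribʳ _ _ _) ⟩
          (Q^ j * gauss i (suc j)) * term (suc i) 0 + gauss (suc i) j * term (suc i) 0
            ≈⟨ S.+-congʳ (S.*-congˡ (term-suc-0 i)) ⟨
          (Q^ j * gauss i (suc j)) * (mono s (a ℕ.+ suc m ℕ.* i) * term i 0) + gauss (suc i) j * term (suc i) 0
            ≈⟨ S.+-congʳ (*-interchange _ _ _ _) ⟩
          (Q^ j * mono s (a ℕ.+ suc m ℕ.* i)) * (gauss i (suc j) * term i 0) + gauss (suc i) j * term (suc i) 0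
            ≈⟨ S.+-congʳ (S.*-congʳ (Q^-c i j e)) ⟩
          c * (gauss i (suc j) * term i 0) + gauss (suc i) j * term (suc i) 0 ∎

      -- Raising N recentres the sum. The Pascal summand without a power of Q reproduces the old
      -- sum; the other becomes the new monomial times the old sum, by `Q^-term`.
      finiteTheta-suc : ∀ N M → finiteTheta (suc N) M ≈ finiteTheta N M * factors s b (suc m) N
      finiteTheta-suc N M = begin
        finiteTheta (suc N) M
          ≈⟨ antidiagₛ-pascal (λ i j → gauss i j * term i (suc N)) (λ i j → gauss i j * term i N)
               (λ i j → c * (gauss i j * term i N)) (N ℕ.+ M) first last inner ⟩
        finiteTheta N M + antidiagₛ (λ i j → c * (gauss i j * term i N)) (N ℕ.+ M)
          ≈⟨ S.+-congˡ (antidiagₛ-*ˡ c _ (N ℕ.+ M)) ⟩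
        finiteTheta N M + c * finiteTheta N M
          ≈⟨ S.+-congʳ (S.*-identityˡ _) ⟨
        oneₛ * finiteTheta N M + c * finiteTheta N M
          ≈⟨ solveₛ 3 (λ c o t → o :* t :+ c :* t , t :* (o :+ c)) S.refl c oneₛ (finiteTheta N M) ⟩
        finiteTheta N M * (oneₛ + c) ∎
        where
        open SetoidReasoning S.setoid
        c : Series
        c = mono s (b ℕ.+ suc m ℕ.* N)
        first : gauss 0 (suc (N ℕ.+ M)) * term 0 (suc N) ≈ c * (gauss 0 (N ℕ.+ M) * term 0 N)
        first = begin
          gauss 0 (suc (N ℕ.+ M)) * term 0 (suc N)
            ≈⟨ S.*-cong (S.trans (gauss-0 (suc (N ℕ.+ M))) (S.sym (gauss-0 (N ℕ.+ M)))) (S.sym (term-0-suc N)) ⟩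
          gauss 0 (N ℕ.+ M) * (c * term 0 N)
            ≈⟨ solveₛ 3 (λ g c t → g :* (c :* t) , c :* (g :* t)) S.refl (gauss 0 (N ℕ.+ M)) c (term 0 N) ⟩
          c * (gauss 0 (N ℕ.+ M) * term 0 N) ∎
        last : gauss (suc (N ℕ.+ M)) 0 * term (N ℕ.+ M) N ≈ gauss (N ℕ.+ M) 0 * term (N ℕ.+ M) N
        last = S.*-congʳ (S.trans (gauss-comm (suc (N ℕ.+ M)) 0) (S.trans (gauss-0 (suc (N ℕ.+ M)))
                         (S.sym (S.trans (gauss-comm (N ℕ.+ M) 0) (gauss-0 (N ℕ.+ M))))))
        inner : ∀ i j → suc i ℕ.+ j ≡ N ℕ.+ M →
                gauss (suc i) (suc j) * term i N ≈
                gauss i (suc j) * term i N + c * (gauss (suc i) j * term (suc i) N)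
        inner i j _ = begin
          gauss (suc i) (suc j) * term i N
            ≈⟨ S.*-congʳ (gauss-pascalˡ i j) ⟩
          (gauss i (suc j) + Q^ i * gauss (suc i) j) * term i N
            ≈⟨ solveₛ 4 (λ g h u t → (g :+ u :* h) :* t , g :* t :+ (u :* t) :* h) S.refl
                 (gauss i (suc j)) (gauss (suc i) j) (Q^ i) (term i N) ⟩
          gauss i (suc j) * term i N + (Q^ i * term i N) * gauss (suc i) j
            ≈⟨ S.+-congˡ (S.*-congʳ (Q^-term i N)) ⟩
          gauss i (suc j) * term i N + (c * term (suc i) N) * gauss (suc i) j
            ≈⟨ solveₛ 4 (λ g c t h → g :+ (c :* t) :* h , g :+ c :* (h :* t)) S.refl
                 (gauss i (suc j) * term i N) c (term (suc i) N) (gauss (suc i) j) ⟩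
          gauss i (suc j) * term i N + c * (gauss (suc i) j * term (suc i) N) ∎

      -- The a-side is built up first, at N = 0 where every index k is nonnegative; the b-side
      -- follows.
      finiteTheta-product : ∀ N M → finiteTheta N M ≈
                            partialProd (factors s a (suc m)) M * partialProd (factors s b (suc m)) N
      finiteTheta-product zero    zero    = S.trans finiteTheta-0-0 (S.sym (S.*-identityˡ oneₛ))
      finiteTheta-product zero    (suc M) = begin
        finiteTheta 0 (suc M)                         ≈⟨ finiteTheta-0-suc M ⟩
        finiteTheta 0 M * factors s a (suc m) M       ≈⟨ S.*-congʳ (finiteTheta-product 0 M) ⟩
        (partialProd (factors s a (suc m)) M * oneₛ) * factors s a (suc m) M
          ≈⟨ solveₛ 3 (λ p o f → (p :* o) :* f , (p :* f) :* o) S.refl _ _ _ ⟩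
        (partialProd (factors s a (suc m)) M * factors s a (suc m) M) * oneₛ ∎
        where open SetoidReasoning S.setoid
      finiteTheta-product (suc N) M       =
        S.trans (finiteTheta-suc N M) (S.trans (S.*-congʳ (finiteTheta-product N M)) (S.*-assoc _ _ _))

      private
        2n+2≡ : ∀ n → double (suc n) ≡ suc (suc n) ℕ.+ n
        2n+2≡ n = cong (suc ∘ suc) (double≡ n)

        -- N ≥ 2n + 2 and i ≤ n force k ≤ -(n+2), hence an exponent of at least n + 1.
        term-small : ∀ {n N i} → double (suc n) ≤ N → i ≤ n → term i N ≈[ n ] 0ₛ
        term-small {n} {N} {i} 2n+2≤N i≤n with ℕ.m≤n⇒∃[o]m+o≡n (ℕ.≤-trans
          (≡.subst (i ℕ.+ suc (suc n) ≤_) (≡.trans (ℕ.+-comm n _) (≡.sym (2n+2≡ n))) (ℕ.+-monoˡ-≤ _ i≤n)) 2n+2≤N)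
        ... | d , refl = mono-≈[]-0 _ (≡.subst (λ k → n < expo a b (suc m) i k) (≡.sym (ℕ.+-assoc i (suc (suc n)) d))
                                       (ℕ.≤-trans (ℕ.m≤m+n (suc n) d) (expo-left a b m i (suc n ℕ.+ d))))

      term-large : ∀ {n N i} → N ℕ.+ suc (suc n) ≤ i → term i N ≈[ n ] 0ₛ
      term-large {n} {N} {i} le with ℕ.m≤n⇒∃[o]m+o≡n le
      ... | d , refl = mono-≈[]-0 _ (≡.subst (λ k → n < expo a b (suc m) k N) (≡.sym (ℕ.+-assoc N (suc (suc n)) d))
                                     (ℕ.≤-trans (ℕ.m≤m+n (suc n) d) (expo-right a b m N (suc n ℕ.+ d))))

      -- If i and j both exceed n, `gauss-limit` absorbs the Gaussian binomial into J. Otherwise |i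
      -- - N| is at least n + 2, because i + j = 2N and N ≥ 2n + 2, and the term is 0 modulo q^(n+1)
      -- with or without its coefficient.
      jacobi-triple : ∀ {c n N} → ⊖ c ≡ s → double (suc n) ≤ N →
                      theta c a b (suc m) ≈[ n ] total (λ i → term i N) (N ℕ.+ N)
      jacobi-triple {c} {n} {N} refl 2n+2≤N = begin
        (poch c a (suc m) * poch c b (suc m)) * J
          ≈⟨ *-cong[] (*-cong[] (poch-limit a) (poch-limit b)) ≈[].refl ⟩
        (partialProd (factors s a (suc m)) N * partialProd (factors s b (suc m)) N) * J
          ≈⟨ ≈⇒≈[] (S.trans (S.*-comm _ _) (S.*-congˡ (S.sym (finiteTheta-product N N)))) ⟩
        J * finiteTheta N N
          ≈⟨ ≈⇒≈[] (antidiagₛ-*ˡ J _ (N ℕ.+ N)) ⟨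
        antidiagₛ (λ i j → J * (gauss i j * term i N)) (N ℕ.+ N)
          ≈⟨ antidiagₛ-cong[] (N ℕ.+ N) limit ⟩
        total (λ i → term i N) (N ℕ.+ N) ∎
        where
        open SetoidReasoning (≈[]-setoid n)
        J : Series
        J = poch 1# (suc m) (suc m)
        n<N : n < N
        n<N = ℕ.≤-trans (≡.subst (suc n ≤_) (≡.sym (2n+2≡ n)) (ℕ.m≤n⇒m≤1+n (ℕ.m≤m+n (suc n) n))) 2n+2≤N
        poch-limit : ∀ a → poch c a (suc m) ≈[ n ] partialProd (factors s a (suc m)) N
        poch-limit a = ≈[].trans (≈⇒≈[] (poch-factors c a (suc m)))
                                 (infProd-partialProd {factors s a (suc m)} (factors-convergent s a m) n<N)
        vanish : ∀ {f g h} → h ≈[ n ] 0ₛ → f * (g * h) ≈[ n ] h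
        vanish {f} {g} {h} h≈0 = ≈[].trans (*-cong[] {f = f} ≈[].refl (*-cong[] {f = g} ≈[].refl h≈0))
          (≈[].trans (≈⇒≈[] (S.trans (S.*-congˡ (S.zeroʳ g)) (S.zeroʳ f))) (≈[].sym h≈0))
        large : ∀ {i j} → j ≤ n → i ℕ.+ j ≡ N ℕ.+ N → N ℕ.+ suc (suc n) ≤ i
        large {i} {j} j≤n i+j≡2N = ℕ.+-cancelʳ-≤ j _ _ (ℕ.≤-trans
          (ℕ.≤-reflexive (ℕ.+-assoc N (suc (suc n)) j))
          (≡.subst (N ℕ.+ (suc (suc n) ℕ.+ j) ≤_) (≡.sym i+j≡2N)
            (ℕ.+-monoʳ-≤ N (ℕ.≤-trans (≡.subst (suc (suc n) ℕ.+ j ≤_) (≡.sym (2n+2≡ n)) (ℕ.+-monoʳ-≤ (suc (suc n)) j≤n)) 2n+2≤N))))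
        limit : ∀ i j → i ℕ.+ j ≡ N ℕ.+ N → J * (gauss i j * term i N) ≈[ n ] term i N
        limit i j i+j≡2N with i ℕ.≤? n | j ℕ.≤? n
        ... | yes i≤n | _       = vanish (term-small 2n+2≤N i≤n)
        ... | no _    | yes j≤n = vanish (term-large (large j≤n i+j≡2N))
        ... | no i≰n  | no j≰n  = begin
          J * (gauss i j * term i N)   ≈⟨ ≈⇒≈[] (solveₛ 3 (λ p g t → p :* (g :* t) , (g :* p) :* t) S.refl J (gauss i j) (term i N)) ⟩
          (gauss i j * J) * term i N   ≈⟨ *-cong[] (gauss-limit (ℕ.≰⇒> i≰n) (ℕ.≰⇒> j≰n)) ≈[].refl ⟩
          oneₛ * term i N              ≈⟨ ≈⇒≈[] (S.*-identityˡ _) ⟩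
          term i N                     ∎

  -- The triple product is expanded with its centre at the even index `double N`, so the parity of i
  -- is that of k; each half is then a triple product centred at N.
  theta-dissect : ∀ {c} → (⊖ c) ⊗ (⊖ c) ≡ 1# → ∀ a d m → let b = a ℕ.+ d in a ℕ.+ b ≡ suc m →
                  theta c a b (suc m) ≈
                  theta (⊖ 1#) (2 ℕ.* a ℕ.+ suc m) (2 ℕ.* b ℕ.+ suc m) (4 ℕ.* suc m)
                  + mono (⊖ c) a * theta (⊖ 1#) (2 ℕ.* a ℕ.+ 3 ℕ.* suc m) d (4 ℕ.* suc m)
  theta-dissect {c} s²≡1 a d m a+b≡1+m = ≈[]⇒≈ λ n → main n (double (suc n)) ℕ.≤-refl
    where
    s : A
    s = ⊖ c
    b m₄ : ℕ
    b  = a ℕ.+ d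
    m₄ = m ℕ.+ 3 ℕ.* suc m
    term even odd : ℕ → ℕ → Series
    term = thetaTerm s a b (suc m)
    even = thetaTerm 1# (2 ℕ.* a ℕ.+ suc m) (2 ℕ.* b ℕ.+ suc m) (4 ℕ.* suc m)
    odd  = thetaTerm 1# (2 ℕ.* a ℕ.+ 3 ℕ.* suc m) d (4 ℕ.* suc m)
    even-sum : ∀ {k} → a ℕ.+ (a ℕ.+ d) ≡ k → (2 ℕ.* a ℕ.+ k) ℕ.+ (2 ℕ.* (a ℕ.+ d) ℕ.+ k) ≡ 4 ℕ.* k
    even-sum refl = ℕ-solve (a ∷ d ∷ [])
    odd-sum : ∀ {k} → a ℕ.+ (a ℕ.+ d) ≡ k → (2 ℕ.* a ℕ.+ 3 ℕ.* k) ℕ.+ d ≡ 4 ℕ.* k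
    odd-sum refl = ℕ-solve (a ∷ d ∷ [])
    1²≡1 : 1# ⊗ 1# ≡ 1#
    1²≡1 = A.*-identityˡ 1#
    term-even : ∀ i N → term (double i) (double N) ≈ even i N
    term-even i N = mono-≡ (sign-even s²≡1 i N) (expo-even a b (suc m) i N)
    term-odd : ∀ i N → term (suc (double i)) (double N) ≈ mono s a * odd i N
    term-odd i N = S.trans
      (mono-≡ (sign-odd s²≡1 i N)
        (≡.subst (λ m → expo a b m (suc (double i)) (double N) ≡ a ℕ.+ expo (2 ℕ.* a ℕ.+ 3 ℕ.* m) d (4 ℕ.* m) i N)
                 a+b≡1+m (expo-odd a d i N)))
      (S.sym (mono-* s a (sign 1# i N) _))
    main : ∀ n N → double (suc n) ≤ N → _ ≈[ n ] _
    main n N 2n+2≤N = begin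
      theta c a b (suc m)
        ≈⟨ jacobi-triple s²≡1 a b m a+b≡1+m refl (ℕ.≤-trans 2n+2≤N (n≤double N)) ⟩
      total f (double N ℕ.+ double N)
        ≈⟨ ≈⇒≈[] (S.trans (S.reflexive (cong (total f) (≡.sym (double≡ (double N))))) (S.sym (S.+-identityʳ _))) ⟩
      -- The sum has 4N + 1 terms. One more term, zero modulo q^(n+1), makes the number even so that
      -- it splits by parity.
      total f (double (double N)) + 0ₛ
        ≈⟨ +-cong[] ≈[].refl (term-large s²≡1 a b m a+b≡1+m last) ⟨
      total f (double (double N)) + f (suc (double (double N)))
        ≈⟨ ≈⇒≈[] (antidiagₛ-snoc (λ i _ → f i) (double (double N))) ⟨
      total f (suc (double (double N)))
        ≈⟨ ≈⇒≈[] (total-parity f (double N)) ⟩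
      total (f ∘ double) (double N) + total (f ∘ suc ∘ double) (double N)
        ≈⟨ ≈⇒≈[] (S.+-cong (antidiagₛ-cong (double N) λ i _ _ → term-even i N)
             (S.trans (antidiagₛ-cong (double N) λ i _ _ → term-odd i N) (antidiagₛ-*ˡ (mono s a) _ (double N)))) ⟩
      total (λ i → even i N) (double N) + mono s a * total (λ i → odd i N) (double N)
        ≈⟨ ≈⇒≈[] (S.reflexive (cong (λ k → total (λ i → even i N) k + mono s a * total (λ i → odd i N) k) (double≡ N))) ⟩
      total (λ i → even i N) (N ℕ.+ N) + mono s a * total (λ i → odd i N) (N ℕ.+ N)
        ≈⟨ +-cong[] (jacobi-triple 1²≡1 (2 ℕ.* a ℕ.+ suc m) (2 ℕ.* b ℕ.+ suc m) m₄ (even-sum a+b≡1+m) (A.-‿involutive 1#) 2n+2≤N)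
                    (*-cong[] ≈[].refl
                      (jacobi-triple 1²≡1 (2 ℕ.* a ℕ.+ 3 ℕ.* suc m) d m₄ (odd-sum a+b≡1+m) (A.-‿involutive 1#) 2n+2≤N)) ⟨
      theta (⊖ 1#) (2 ℕ.* a ℕ.+ suc m) (2 ℕ.* b ℕ.+ suc m) (4 ℕ.* suc m)
        + mono s a * theta (⊖ 1#) (2 ℕ.* a ℕ.+ 3 ℕ.* suc m) d (4 ℕ.* suc m) ∎
      where
      open SetoidReasoning (≈[]-setoid n)
      f : ℕ → Series
      f i = term i (double N)
      last : double N ℕ.+ suc (suc n) ≤ suc (double (double N))
      last = ≡.subst (λ k → double N ℕ.+ suc (suc n) ≤ suc k) (≡.sym (double≡ (double N)))
        (≡.subst (_≤ suc (double N ℕ.+ double N)) (≡.sym (ℕ.+-suc (double N) (suc n)))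
          (s≤s (ℕ.+-monoʳ-≤ (double N) (ℕ.≤-trans (n≤double (suc n)) (ℕ.≤-trans 2n+2≤N (n≤double N))))))

-- Infinite products

module EulerProducts {A : Set} {_⊕_ _⊗_ : A → A → A} {⊖_ : A → A} {0# 1# : A}
                     (isCR : IsCommutativeRing _≡_ _⊕_ _⊗_ ⊖_ 0# 1#) where

  open PowerSeries isCR
  open JacobiTriple isCR
  open SemiringSolver series using (_:+_; _:*_) renaming (solve to solveₛ)

  private
    module A where
      open CommutativeRing coefficients public
      open RingProperties ring public

  -- Off by one, inherited from `geom`: this is 1/(x q^(a+1); q^m).
  geoms : A → ℕ → ℕ → Series
  geoms x a m = infProd (λ i → geom x (a ℕ.+ m ℕ.* i))

  geoms-inverse : ∀ x a m → geoms x a (suc m) * poch x (suc a) (suc m) ≈ oneₛ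
  geoms-inverse x a m = begin
    geoms x a (suc m) * poch x (suc a) (suc m)
      ≈⟨ S.*-congˡ (poch-factors x (suc a) (suc m)) ⟩
    geoms x a (suc m) * infProd (factors (⊖ x) (suc a) (suc m))
      ≈⟨ infProd-* {λ i → geom x (a ℕ.+ suc m ℕ.* i)} {factors (⊖ x) (suc a) (suc m)}
           (λ i → geom-≈[]-1 x _ (ℕ.≤-trans (ℕ.m≤n⇒m≤1+n ℕ.≤-refl)
                    (ℕ.≤-trans (ℕ.m≤m+n (suc i) (m ℕ.* suc i)) (ℕ.m≤n+m _ a))))
           (factors-convergent (⊖ x) (suc a) m) ⟩
    infProd (λ i → geom x (a ℕ.+ suc m ℕ.* i) * factors (⊖ x) (suc a) (suc m) i)
      ≈⟨ infProd-1 (λ i → geom-inverse x (a ℕ.+ suc m ℕ.* i)) ⟩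
    oneₛ ∎
    where open SetoidReasoning S.setoid

  geoms-0-1 : ∀ x → geoms x 0 1 ≈ infProd (geom x)
  geoms-0-1 x = infProd-cong λ i → S.reflexive (cong (geom x) (ℕ.*-identityˡ i))

  inverse-unique : ∀ {f g h} → f * h ≈ oneₛ → g * h ≈ oneₛ → f ≈ g
  inverse-unique {f} {g} {h} fh≈1 gh≈1 = begin
    f            ≈⟨ S.*-identityʳ f ⟨
    f * oneₛ     ≈⟨ S.*-congˡ gh≈1 ⟨
    f * (g * h)  ≈⟨ solveₛ 3 (λ f g h → f :* (g :* h) , (f :* h) :* g) S.refl f g h ⟩
    (f * h) * g  ≈⟨ S.*-congʳ fh≈1 ⟩
    oneₛ * g     ≈⟨ S.*-identityˡ g ⟩
    g            ∎
    where open SetoidReasoning S.setoid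

  poch-dissect : ∀ c a m → poch c a (suc m) ≈ poch c a (2 ℕ.* suc m) * poch c (a ℕ.+ suc m) (2 ℕ.* suc m)
  poch-dissect c a m = begin
    poch c a (suc m)
      ≈⟨ poch-factors c a (suc m) ⟩
    infProd F
      ≈⟨ infProd-dissect {F} (factors-convergent s a m)
           (λ i → binomial-≈[]-1 s _ (bound (suc i) (double (suc i)) a (n≤double (suc i))))
           (λ i → binomial-≈[]-1 s _ (bound (suc i) (suc (double (suc i))) a (ℕ.m≤n⇒m≤1+n (n≤double (suc i))))) ⟩
    infProd (F ∘ double) * infProd (F ∘ suc ∘ double)
      ≈⟨ S.*-cong (infProd-cong λ i → S.+-congˡ (mono-≡ refl (even i)))
                  (infProd-cong λ i → S.+-congˡ (mono-≡ refl (odd i))) ⟩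
    infProd (factors s a (2 ℕ.* suc m)) * infProd (factors s (a ℕ.+ suc m) (2 ℕ.* suc m))
      ≈⟨ S.*-cong (poch-factors c a (2 ℕ.* suc m)) (poch-factors c (a ℕ.+ suc m) (2 ℕ.* suc m)) ⟨
    poch c a (2 ℕ.* suc m) * poch c (a ℕ.+ suc m) (2 ℕ.* suc m) ∎
    where
    open SetoidReasoning S.setoid
    s : A
    s = ⊖ c
    F : ℕ → Series
    F = factors s a (suc m)
    bound : ∀ i k a → i ≤ k → i ≤ a ℕ.+ suc m ℕ.* k
    bound i k a i≤k = ℕ.≤-trans i≤k (ℕ.≤-trans (ℕ.m≤m+n k (m ℕ.* k)) (ℕ.m≤n+m _ a))
    even : ∀ i → a ℕ.+ suc m ℕ.* double i ≡ a ℕ.+ 2 ℕ.* suc m ℕ.* i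
    even i rewrite double≡ i = ℕ-solve (a ∷ m ∷ i ∷ [])
    odd : ∀ i → a ℕ.+ suc m ℕ.* suc (double i) ≡ (a ℕ.+ suc m) ℕ.+ 2 ℕ.* suc m ℕ.* i
    odd i rewrite double≡ i = ℕ-solve (a ∷ m ∷ i ∷ [])

  poch-square : ∀ c a m → poch c a (suc m) * poch (⊖ c) a (suc m) ≈
                          poch (c ⊗ c) (2 ℕ.* a) (2 ℕ.* suc m)
  poch-square c a m = begin
    poch c a (suc m) * poch (⊖ c) a (suc m)
      ≈⟨ S.*-cong (poch-factors c a (suc m)) (poch-factors (⊖ c) a (suc m)) ⟩
    infProd (factors s a (suc m)) * infProd (factors (⊖ s) a (suc m))
      ≈⟨ infProd-* {factors s a (suc m)} {factors (⊖ s) a (suc m)}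
           (factors-convergent s a m) (factors-convergent (⊖ s) a m) ⟩
    infProd (λ i → factors s a (suc m) i * factors (⊖ s) a (suc m) i)
      ≈⟨ infProd-cong square ⟩
    infProd (factors (⊖ (c ⊗ c)) (2 ℕ.* a) (2 ℕ.* suc m))
      ≈⟨ poch-factors (c ⊗ c) (2 ℕ.* a) (2 ℕ.* suc m) ⟨
    poch (c ⊗ c) (2 ℕ.* a) (2 ℕ.* suc m) ∎
    where
    open SetoidReasoning S.setoid
    s : A
    s = ⊖ c
    -c² : s ⊗ (⊖ s) ≡ ⊖ (c ⊗ c)
    -c² = ≡.trans (cong (s ⊗_) (A.-‿involutive c)) (≡.sym (A.-‿distribˡ-* c c))
    exponent : ∀ i → (a ℕ.+ suc m ℕ.* i) ℕ.+ (a ℕ.+ suc m ℕ.* i) ≡ 2 ℕ.* a ℕ.+ 2 ℕ.* suc m ℕ.* i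
    exponent i = ℕ-solve (a ∷ m ∷ i ∷ [])
    square : ∀ i → factors s a (suc m) i * factors (⊖ s) a (suc m) i ≈
                   factors (⊖ (c ⊗ c)) (2 ℕ.* a) (2 ℕ.* suc m) i
    square i = begin
      (oneₛ + u) * (oneₛ + v)
        ≈⟨ solveₛ 3 (λ o u v → (o :+ u) :* (o :+ v) , o :* o :+ ((u :* o :+ o :* v) :+ u :* v)) S.refl oneₛ u v ⟩
      oneₛ * oneₛ + ((u * oneₛ + oneₛ * v) + u * v)
        ≈⟨ S.+-cong (S.*-identityˡ oneₛ) (S.+-cong
             (S.trans (S.+-cong (S.*-identityʳ u) (S.*-identityˡ v)) (mono-inverse s (⊖ s) e (A.-‿inverseʳ s)))
             (S.trans (mono-* s e (⊖ s) e) (mono-≡ -c² (exponent i)))) ⟩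
      oneₛ + (0ₛ + mono (⊖ (c ⊗ c)) (2 ℕ.* a ℕ.+ 2 ℕ.* suc m ℕ.* i))
        ≈⟨ S.+-congˡ (S.+-identityˡ _) ⟩
      oneₛ + mono (⊖ (c ⊗ c)) (2 ℕ.* a ℕ.+ 2 ℕ.* suc m ℕ.* i) ∎
      where
      e : ℕ
      e = a ℕ.+ suc m ℕ.* i
      u v : Series
      u = mono s e
      v = mono (⊖ s) e

  -- D = (q;q²)_∞, the Euler inverse of N = (-q;q)_∞.
  D N Nₒ Nₑ : Series
  D  = poch 1# 1 2
  N  = poch (⊖ 1#) 1 1
  Nₒ = poch (⊖ 1#) 1 2
  Nₑ = poch (⊖ 1#) 2 2

  -- (q;q)(-q;q) = (q²;q²) and (q;q) = (q;q²)(q²;q²); the common (q²;q²) is removed by multiplying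
  -- with its explicit inverse.
  D*N≈1 : D * N ≈ oneₛ
  D*N≈1 = begin
    D * N                            ≈⟨ S.*-identityʳ _ ⟨
    (D * N) * oneₛ                   ≈⟨ S.*-congˡ (geoms-inverse 1# 1 1) ⟨
    (D * N) * (E⁻¹ * E)              ≈⟨ solveₛ 4 (λ d n e f → (d :* n) :* (f :* e) , f :* ((d :* e) :* n)) S.refl D N E E⁻¹ ⟩
    E⁻¹ * ((D * E) * N)              ≈⟨ S.*-congˡ (S.*-congʳ (poch-dissect 1# 1 0)) ⟨
    E⁻¹ * (poch 1# 1 1 * N)          ≈⟨ S.*-congˡ (poch-square 1# 1 0) ⟩
    E⁻¹ * poch (1# ⊗ 1#) 2 2         ≈⟨ S.*-congˡ (S.reflexive (cong (λ c → poch c 2 2) (A.*-identityˡ 1#))) ⟩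
    E⁻¹ * E                          ≈⟨ geoms-inverse 1# 1 1 ⟩
    oneₛ                             ∎
    where
    open SetoidReasoning S.setoid
    E E⁻¹ : Series
    E   = poch 1# 2 2
    E⁻¹ = geoms 1# 1 2

  crankAt : A → A → Series
  crankAt x x⁻¹ = poch 1# 1 1 * (geoms x 0 1 * geoms x⁻¹ 0 1)

  crankAt-1 : crankAt 1# 1# ≈ geoms 1# 0 1
  crankAt-1 = begin
    P * (G * G)  ≈⟨ solveₛ 2 (λ p g → p :* (g :* g) , (g :* p) :* g) S.refl P G ⟩
    (G * P) * G  ≈⟨ S.*-congʳ (geoms-inverse 1# 0 0) ⟩
    oneₛ * G     ≈⟨ S.*-identityˡ G ⟩
    G            ∎
    where
    open SetoidReasoning S.setoid
    P G : Series
    P = poch 1# 1 1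
    G = geoms 1# 0 1

  crankAt-−1 : crankAt (⊖ 1#) (⊖ 1#) ≈ poch 1# 1 1 * (D * D)
  crankAt-−1 = S.*-congˡ (S.*-cong G≈D G≈D)
    where
    G≈D : geoms (⊖ 1#) 0 1 ≈ D
    G≈D = inverse-unique (geoms-inverse (⊖ 1#) 0 0) D*N≈1

  -- (iq;q)(-iq;q) = (-q²;q²), and its inverse comes from Euler's identity with (-q;q) =
  -- (-q;q²)(-q²;q²). The result is free of i, which later permits the descent to ℚ.
  crankAt-i : ∀ {i} → i ⊗ i ≡ ⊖ 1# → crankAt i (⊖ i) ≈ poch 1# 1 1 * (D * Nₒ)
  crankAt-i {i} i²≡-1 = S.*-congˡ (inverse-unique G*Nₑ≈1 D*Nₒ*Nₑ≈1)
    where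
    open SetoidReasoning S.setoid
    G*Nₑ≈1 : (geoms i 0 1 * geoms (⊖ i) 0 1) * Nₑ ≈ oneₛ
    G*Nₑ≈1 = begin
      (geoms i 0 1 * geoms (⊖ i) 0 1) * Nₑ
        ≈⟨ S.*-congˡ (S.reflexive (cong (λ c → poch c 2 2) i²≡-1)) ⟨
      (geoms i 0 1 * geoms (⊖ i) 0 1) * poch (i ⊗ i) 2 2
        ≈⟨ S.*-congˡ (poch-square i 1 0) ⟨
      (geoms i 0 1 * geoms (⊖ i) 0 1) * (poch i 1 1 * poch (⊖ i) 1 1)
        ≈⟨ *-interchange _ _ _ _ ⟩
      (geoms i 0 1 * poch i 1 1) * (geoms (⊖ i) 0 1 * poch (⊖ i) 1 1)
        ≈⟨ S.*-cong (geoms-inverse i 0 0) (geoms-inverse (⊖ i) 0 0) ⟩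
      oneₛ * oneₛ
        ≈⟨ S.*-identityˡ oneₛ ⟩
      oneₛ ∎
    D*Nₒ*Nₑ≈1 : (D * Nₒ) * Nₑ ≈ oneₛ
    D*Nₒ*Nₑ≈1 = S.trans (S.*-assoc D Nₒ Nₑ) (S.trans (S.*-congˡ (S.sym (poch-dissect (⊖ 1#) 1 0))) D*N≈1)

  thetaBar : ℕ → ℕ → ℕ → Series
  thetaBar = theta (⊖ 1#)

  private
    -1²≡1 : (⊖ 1#) ⊗ (⊖ 1#) ≡ 1#
    -1²≡1 = ≡.trans (A.-1*x≈-x _) (A.-‿involutive 1#)

  -- Ramanujan's φ(-q) = j(q;q²). The odd half arises with parameters 8, 0 and is commuted to 0, 8.
  φ-dissect : thetaBar 4 4 8 + mono (⊖ 1#) 1 * thetaBar 0 8 8 ≈ (D * D) * poch 1# 2 2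
  φ-dissect = S.sym (S.trans (theta-dissect -1²≡1 1 0 1 refl)
    (S.+-congˡ (S.*-congˡ (S.*-congʳ (S.*-comm _ _)))))

  -- Ramanujan's ψ(-cq) = j(cq;q⁴); c = 1 will serve z = -1 and c = -1 will serve z = i.
  ψ-dissect : ∀ {c} → (⊖ c) ⊗ (⊖ c) ≡ 1# →
              thetaBar 6 10 16 + mono (⊖ c) 1 * thetaBar 14 2 16 ≈ poch c 1 2 * poch 1# 4 4
  ψ-dissect {c} c²≡1 = S.sym (S.trans (S.*-congʳ (poch-dissect c 1 1)) (theta-dissect c²≡1 1 2 3 refl))

  -- J₄ cancels against the ψ-factor, and one of the two (q;q²) in φ combines with J₂ to give J₁.
  φψ : ∀ {c} → (⊖ c) ⊗ (⊖ c) ≡ 1# →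
       geoms 1# 3 4 * ((thetaBar 4 4 8 + mono (⊖ 1#) 1 * thetaBar 0 8 8) *
                       (thetaBar 6 10 16 + mono (⊖ c) 1 * thetaBar 14 2 16)) ≈
       poch 1# 1 1 * (D * poch c 1 2)
  φψ {c} c²≡1 = begin
    J₄⁻¹ * ((thetaBar 4 4 8 + mono (⊖ 1#) 1 * thetaBar 0 8 8) *
            (thetaBar 6 10 16 + mono (⊖ c) 1 * thetaBar 14 2 16))
      ≈⟨ S.*-congˡ (S.*-cong φ-dissect (ψ-dissect c²≡1)) ⟩
    J₄⁻¹ * (((D * D) * J₂) * (poch c 1 2 * J₄))
      ≈⟨ solveₛ 5 (λ f d e n g → f :* (((d :* d) :* e) :* (n :* g)) , (f :* g) :* ((d :* e) :* (d :* n))) S.refl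
           J₄⁻¹ D J₂ (poch c 1 2) J₄ ⟩
    (J₄⁻¹ * J₄) * ((D * J₂) * (D * poch c 1 2))
      ≈⟨ S.trans (S.*-congʳ (geoms-inverse 1# 3 3)) (S.*-identityˡ _) ⟩
    (D * J₂) * (D * poch c 1 2)
      ≈⟨ S.*-congʳ (poch-dissect 1# 1 0) ⟨
    poch 1# 1 1 * (D * poch c 1 2) ∎
    where
    open SetoidReasoning S.setoid
    J₂ J₄ J₄⁻¹ : Series
    J₂   = poch 1# 2 2
    J₄   = poch 1# 4 4
    J₄⁻¹ = geoms 1# 3 4

-- Evaluation of Laurent polynomials

-- L carries bare operations without laws, since formal sums stored as lists obey the ring laws only
-- after evaluation. The map h is therefore pushed through the defining recursions of series and
-- products.
module MapSeries {L : Set} {0L 1L : L} {_+L_ _*L_ : L → L → L} { -L_ : L → L}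
                 {A : Set} {_⊕_ _⊗_ : A → A → A} {⊖_ : A → A} {0# 1# : A}
                 (isCR : IsCommutativeRing _≡_ _⊕_ _⊗_ ⊖_ 0# 1#)
                 (h : L → A) (h-0 : h 0L ≡ 0#) (h-1 : h 1L ≡ 1#) (h-neg : ∀ x → h (-L x) ≡ ⊖ h x)
                 (h-+ : ∀ x y → h (x +L y) ≡ h x ⊕ h y) (h-* : ∀ x y → h (x *L y) ≡ h x ⊗ h y) where

  private
    module L = PS 0L 1L _+L_ _*L_ -L_
  open PowerSeries isCR

  map-*ₛ : ∀ f g → h ∘ (f L.*ₛ g) ≈ (h ∘ f) * (h ∘ g)
  map-*ₛ f g = S.trans (ptwise λ n → map-sumTo (λ k → f k *L g (n ∸ k)) (λ k → h-* (f k) (g (n ∸ k))) n)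
                       (*-def (h ∘ f) (h ∘ g))
    where
    map-sumTo : ∀ f {g} → (∀ k → h (f k) ≡ g k) → ∀ n → h (L.sumTo f n) ≡ sumTo g n
    map-sumTo f hf≡g zero    = hf≡g 0
    map-sumTo f hf≡g (suc n) = ≡.trans (h-+ _ _) (cong₂ _⊕_ (map-sumTo f hf≡g n) (hf≡g (suc n)))

  map-geom : ∀ x {y} → h x ≡ y → ∀ e → h ∘ L.geom x e ≈ geom y e
  map-geom x refl e = ptwise λ n → case-if ⌊ n ℕ.% suc e ℕ.≟ 0 ⌋ (n ℕ./ suc e)
    where
    map-powA : ∀ k → h (L.powA x k) ≡ powA (h x) k
    map-powA zero    = h-1
    map-powA (suc k) = ≡.trans (h-* x _) (cong (h x ⊗_) (map-powA k))
    case-if : ∀ b k → h (if b then L.powA x k else 0L) ≡ (if b then powA (h x) k else 0#)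
    case-if true  k = map-powA k
    case-if false k = h-0

  map-infProd : ∀ F {G} → (∀ i → h ∘ F i ≈ G i) → h ∘ L.infProd F ≈ infProd G
  map-infProd F {G} hF≈G = ptwise λ n → at (map-prodUpTo n) n
    where
    map-prodUpTo : ∀ n → h ∘ L.prodUpTo F n ≈ prodUpTo G n
    map-prodUpTo zero    = hF≈G 0
    map-prodUpTo (suc n) = S.trans (map-*ₛ (L.prodUpTo F n) (F (suc n)))
      (S.trans (S.*-cong (map-prodUpTo n) (hF≈G (suc n))) (S.sym (prodUpTo-suc G n)))

  map-poch : ∀ c {d} → h c ≡ d → ∀ a m → h ∘ L.poch c a m ≈ poch d a m
  map-poch c refl a m = map-infProd _ λ i → ptwise λ n →
    ≡.trans (h-+ _ _) (cong₂ _⊕_ (map-oneₛ n) (case-if ⌊ n ℕ.≟ a ℕ.+ m ℕ.* i ⌋))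
    where
    map-oneₛ : ∀ n → h (L.oneₛ n) ≡ oneₛ n
    map-oneₛ zero    = h-1
    map-oneₛ (suc n) = h-0
    case-if : ∀ b → h (if b then (-L c) else 0L) ≡ (if b then (⊖ h c) else 0#)
    case-if true  = h-neg c
    case-if false = h-0

module LaurentEvaluation
  {A : Set} {_⊕_ _⊗_ : A → A → A} {⊖_ : A → A} {0# 1# : A}
  (isCR : IsCommutativeRing _≡_ _⊕_ _⊗_ ⊖_ 0# 1#)
  (κ : ℤ → A) (κ-1 : κ (+ 1) ≡ 1#) (κ-neg : ∀ a → κ (ℤ.- a) ≡ ⊖ κ a)
  (κ-+ : ∀ a b → κ (a ℤ.+ b) ≡ κ a ⊕ κ b) (κ-* : ∀ a b → κ (a ℤ.* b) ≡ κ a ⊗ κ b)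
  {x x⁻¹ : A} (x*x⁻¹≡1 : x ⊗ x⁻¹ ≡ 1#) where

  open PowerSeries isCR
  open EulerProducts isCR using (crankAt; geoms; geoms-0-1)
  private
    module A where
      open CommutativeRing coefficients public
      open RingProperties ring public
      open CommutativeSemigroupProperties *-commutativeSemigroup public using (interchange)

  pow : ℤ → A
  pow (+ n)    = powA x n
  pow -[1+ n ] = powA x⁻¹ (suc n)

  powA-+ : ∀ x m n → powA x (m ℕ.+ n) ≡ powA x m ⊗ powA x n
  powA-+ x zero    n = ≡.sym (A.*-identityˡ _)
  powA-+ x (suc m) n = ≡.trans (cong (x ⊗_) (powA-+ x m n)) (≡.sym (A.*-assoc x _ _))

  pow-⊖ : ∀ m n → pow (m ℤ.⊖ n) ≡ powA x m ⊗ powA x⁻¹ n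
  pow-⊖ m       zero    = ≡.sym (A.*-identityʳ _)
  pow-⊖ zero    (suc n) = ≡.sym (A.*-identityˡ _)
  pow-⊖ (suc m) (suc n) = begin
    pow (suc m ℤ.⊖ suc n)                        ≡⟨ cong pow (ℤ.[1+m]⊖[1+n]≡m⊖n m n) ⟩
    pow (m ℤ.⊖ n)                                ≡⟨ pow-⊖ m n ⟩
    powA x m ⊗ powA x⁻¹ n                        ≡⟨ A.*-identityˡ _ ⟨
    1# ⊗ (powA x m ⊗ powA x⁻¹ n)                 ≡⟨ cong (_⊗ (powA x m ⊗ powA x⁻¹ n)) x*x⁻¹≡1 ⟨
    (x ⊗ x⁻¹) ⊗ (powA x m ⊗ powA x⁻¹ n)          ≡⟨ A.interchange _ _ _ _ ⟩
    (x ⊗ powA x m) ⊗ (x⁻¹ ⊗ powA x⁻¹ n)          ∎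
    where open ≡-Reasoning

  pow-+ : ∀ d e → pow (d ℤ.+ e) ≡ pow d ⊗ pow e
  pow-+ (+ m)    (+ n)    = powA-+ x m n
  pow-+ (+ m)    -[1+ n ] = pow-⊖ m (suc n)
  pow-+ -[1+ m ] (+ n)    = ≡.trans (pow-⊖ n (suc m)) (A.*-comm _ _)
  pow-+ -[1+ m ] -[1+ n ] = ≡.trans (cong (powA x⁻¹ ∘ suc) (≡.sym (ℕ.+-suc m n))) (powA-+ x⁻¹ (suc m) (suc n))

  eval : LP → A
  eval []            = 0#
  eval ((e , c) ∷ p) = (κ c ⊗ pow e) ⊕ eval p

  eval-++ : ∀ p r → eval (p ⊕L r) ≡ eval p ⊕ eval r
  eval-++ []            r = ≡.sym (A.+-identityˡ _)
  eval-++ ((e , c) ∷ p) r = ≡.trans (cong ((κ c ⊗ pow e) ⊕_) (eval-++ p r)) (≡.sym (A.+-assoc _ _ _))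

  eval-neg : ∀ p → eval (⊖L p) ≡ ⊖ eval p
  eval-neg []            = ≡.sym A.-0#≈0#
  eval-neg ((e , c) ∷ p) = ≡.trans
    (cong₂ _⊕_ (≡.trans (cong (_⊗ pow e) (κ-neg c)) (≡.sym (A.-‿distribˡ-* _ _))) (eval-neg p))
    (A.-‿+-comm _ _)

  eval-* : ∀ p r → eval (p ⊗L r) ≡ eval p ⊗ eval r
  eval-* []            r = ≡.sym (A.zeroˡ _)
  eval-* ((e , c) ∷ p) r = begin
    eval (((e , c) ∷ p) ⊗L r)                         ≡⟨ eval-term (λ _ _ → refl) r ⟩
    ((κ c ⊗ pow e) ⊗ eval r) ⊕ eval (p ⊗L r)          ≡⟨ cong (((κ c ⊗ pow e) ⊗ eval r) ⊕_) (eval-* p r) ⟩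
    ((κ c ⊗ pow e) ⊗ eval r) ⊕ (eval p ⊗ eval r)      ≡⟨ A.distribʳ (eval r) _ _ ⟨
    ((κ c ⊗ pow e) ⊕ eval p) ⊗ eval r                 ∎
    where
    open ≡-Reasoning
    -- The function mapped by `_⊗L_` is an anonymous pattern-matching lambda; f stands for it, known
    -- only through its values.
    eval-term : ∀ {f : ℤ × ℤ → ℤ × ℤ} {q} → (∀ d b → f (d , b) ≡ (e ℤ.+ d , c ℤ.* b)) →
                ∀ r → eval (map f r ++ q) ≡ ((κ c ⊗ pow e) ⊗ eval r) ⊕ eval q
    eval-term {f} {q} f≡ []            = ≡.sym (≡.trans (cong (_⊕ eval q) (A.zeroʳ _)) (A.+-identityˡ _))
    eval-term {f} {q} f≡ ((d , b) ∷ r) rewrite f≡ d b = ≡.trans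
      (cong₂ _⊕_ (≡.trans (cong₂ _⊗_ (κ-* c b) (pow-+ e d)) (A.interchange _ _ _ _)) (eval-term {f} {q} f≡ r))
      (≡.trans (≡.sym (A.+-assoc _ _ _)) (cong (_⊕ eval q) (≡.sym (A.distribˡ _ _ _))))

  private
    eval-monomial : ∀ e → eval ((e , + 1) ∷ []) ≡ pow e
    eval-monomial e = ≡.trans (A.+-identityʳ _) (≡.trans (cong (_⊗ pow e) κ-1) (A.*-identityˡ _))

    module M = MapSeries {0L = []} {1L = (+ 0 , + 1) ∷ []} {_⊕L_} {_⊗L_} {⊖L_} isCR
                 eval refl (eval-monomial (+ 0)) eval-neg eval-++ eval-*

    map-geoms : ∀ y {d} → eval y ≡ d → eval ∘ LPS.infProd (λ i → LPS.geom y i) ≈ geoms d 0 1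
    map-geoms y {d} y≡d = S.trans (M.map-infProd (LPS.geom y) (M.map-geom y y≡d)) (S.sym (geoms-0-1 d))

    crank-numerator : LPS.Series
    crank-numerator = LPS.poch ((+ 0 , + 1) ∷ []) 1 1

    crank-geoms : LP → LPS.Series
    crank-geoms y = LPS.infProd (λ i → LPS.geom y i)

  eval-crankGF : eval ∘ crankGF ≈ crankAt x x⁻¹
  eval-crankGF = S.trans (M.map-*ₛ crank-numerator (crank-geoms z LPS.*ₛ crank-geoms z⁻¹))
    (S.*-cong (M.map-poch ((+ 0 , + 1) ∷ []) (eval-monomial (+ 0)) 1 1)
    (S.trans (M.map-*ₛ (crank-geoms z) (crank-geoms z⁻¹)) (S.*-cong
      (map-geoms z (≡.trans (eval-monomial (+ 1)) (A.*-identityʳ x)))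
      (map-geoms z⁻¹ (≡.trans (eval-monomial (ℤ.- (+ 1))) (A.*-identityʳ x⁻¹))))))

-- The embedding of ℤ into ℚ as a ring homomorphism

toℚᵘ-toℚ : ∀ a → toℚᵘ (toℚ a) ≃ mkℚᵘ a 0
toℚᵘ-toℚ a = ℚ.toℚᵘ-fromℚᵘ (mkℚᵘ a 0)

-- `ℚ._/_` normalises its fraction, so the comparison is made among unnormalised rationals, where
-- equality is cross-multiplication.
toℚ-+ : ∀ a b → toℚ (a ℤ.+ b) ≡ toℚ a ℚ.+ toℚ b
toℚ-+ a b = ℚ.toℚᵘ-injective (begin
  toℚᵘ (toℚ (a ℤ.+ b))               ≈⟨ toℚᵘ-toℚ (a ℤ.+ b) ⟩
  mkℚᵘ (a ℤ.+ b) 0                   ≈⟨ *≡* (cong (ℤ._* + 1) (≡.sym (cong₂ ℤ._+_ (ℤ.*-identityʳ a) (ℤ.*-identityʳ b)))) ⟩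
  mkℚᵘ a 0 ℚᵘ.+ mkℚᵘ b 0             ≈⟨ ℚᵘ.+-cong (toℚᵘ-toℚ a) (toℚᵘ-toℚ b) ⟨
  toℚᵘ (toℚ a) ℚᵘ.+ toℚᵘ (toℚ b)     ≈⟨ ℚ.toℚᵘ-homo-+ (toℚ a) (toℚ b) ⟨
  toℚᵘ (toℚ a ℚ.+ toℚ b)             ∎)
  where open SetoidReasoning ℚᵘ.≃-setoid

toℚ-* : ∀ a b → toℚ (a ℤ.* b) ≡ toℚ a ℚ.* toℚ b
toℚ-* a b = ℚ.toℚᵘ-injective (begin
  toℚᵘ (toℚ (a ℤ.* b))               ≈⟨ toℚᵘ-toℚ (a ℤ.* b) ⟩
  mkℚᵘ a 0 ℚᵘ.* mkℚᵘ b 0             ≈⟨ ℚᵘ.*-cong (toℚᵘ-toℚ a) (toℚᵘ-toℚ b) ⟨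
  toℚᵘ (toℚ a) ℚᵘ.* toℚᵘ (toℚ b)     ≈⟨ ℚ.toℚᵘ-homo-* (toℚ a) (toℚ b) ⟨
  toℚᵘ (toℚ a ℚ.* toℚ b)             ∎)
  where open SetoidReasoning ℚᵘ.≃-setoid

toℚ-neg : ∀ a → toℚ (ℤ.- a) ≡ ℚ.- toℚ a
toℚ-neg a = ℚ.toℚᵘ-injective (begin
  toℚᵘ (toℚ (ℤ.- a))                 ≈⟨ toℚᵘ-toℚ (ℤ.- a) ⟩
  ℚᵘ.- mkℚᵘ a 0                      ≈⟨ ℚᵘ.-‿cong (toℚᵘ-toℚ a) ⟨
  ℚᵘ.- toℚᵘ (toℚ a)                  ≈⟨ ℚ.toℚᵘ-homo‿- (toℚ a) ⟨
  toℚᵘ (ℚ.- toℚ a)                   ∎)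
  where open SetoidReasoning ℚᵘ.≃-setoid

/4≡toℚ*¼ : ∀ a → a ℚ./ 4 ≡ toℚ a ℚ.* (+ 1 ℚ./ 4)
/4≡toℚ*¼ a = ℚ.toℚᵘ-injective (begin
  toℚᵘ (a ℚ./ 4)                         ≈⟨ ℚ.toℚᵘ-fromℚᵘ (mkℚᵘ a 3) ⟩
  mkℚᵘ a 3                               ≈⟨ *≡* (cong (ℤ._* + 4) (≡.sym (ℤ.*-identityʳ a))) ⟩
  mkℚᵘ a 0 ℚᵘ.* toℚᵘ (+ 1 ℚ./ 4)         ≈⟨ ℚᵘ.*-congʳ (toℚᵘ-toℚ a) ⟨
  toℚᵘ (toℚ a) ℚᵘ.* toℚᵘ (+ 1 ℚ./ 4)     ≈⟨ ℚ.toℚᵘ-homo-* (toℚ a) (+ 1 ℚ./ 4) ⟨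
  toℚᵘ (toℚ a ℚ.* (+ 1 ℚ./ 4))           ∎)
  where open SetoidReasoning ℚᵘ.≃-setoid

ℚ-isCR : IsCommutativeRing _≡_ ℚ._+_ ℚ._*_ ℚ.-_ 0ℚ 1ℚ
ℚ-isCR = ℚ.+-*-isCommutativeRing

-- The Gaussian rationals and the three evaluation points

ℚ[i] : Set
ℚ[i] = ℚ × ℚ

infixl 6 _+ᵢ_
infixl 7 _*ᵢ_

_+ᵢ_ _*ᵢ_ : ℚ[i] → ℚ[i] → ℚ[i]
(a , b) +ᵢ (c , d) = a ℚ.+ c , b ℚ.+ d
(a , b) *ᵢ (c , d) = a ℚ.* c ℚ.- b ℚ.* d , a ℚ.* d ℚ.+ b ℚ.* c

-ᵢ_ : ℚ[i] → ℚ[i]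
-ᵢ (a , b) = ℚ.- a , ℚ.- b

ι : ℚ → ℚ[i]
ι a = a , 0ℚ

𝕚 : ℚ[i]
𝕚 = 0ℚ , 1ℚ

ℚ[i]-isCR : IsCommutativeRing _≡_ _+ᵢ_ _*ᵢ_ -ᵢ_ (ι 0ℚ) (ι 1ℚ)
ℚ[i]-isCR = record
  { isRing = record
    { +-isAbelianGroup = record
      { isGroup = record
        { isMonoid = record
          { isSemigroup = record
            { isMagma = ≡.isMagma _+ᵢ_
            ; assoc   = λ (a , b) (c , d) (e , f) → cong₂ _,_ (ℚ.+-assoc a c e) (ℚ.+-assoc b d f)
            }
          ; identity = (λ (a , b) → cong₂ _,_ (ℚ.+-identityˡ a) (ℚ.+-identityˡ b))
                     , (λ (a , b) → cong₂ _,_ (ℚ.+-identityʳ a) (ℚ.+-identityʳ b))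
          }
        ; inverse = (λ (a , b) → cong₂ _,_ (ℚ.+-inverseˡ a) (ℚ.+-inverseˡ b))
                  , (λ (a , b) → cong₂ _,_ (ℚ.+-inverseʳ a) (ℚ.+-inverseʳ b))
        ; ⁻¹-cong = cong -ᵢ_
        }
      ; comm = λ (a , b) (c , d) → cong₂ _,_ (ℚ.+-comm a c) (ℚ.+-comm b d)
      }
    ; *-cong     = cong₂ _*ᵢ_
    ; *-assoc    = *ᵢ-assoc
    ; *-identity = *ᵢ-identityˡ , λ x → ≡.trans (*ᵢ-comm x (ι 1ℚ)) (*ᵢ-identityˡ x)
    ; distrib    = *ᵢ-distribˡ , λ x y w → ≡.trans (*ᵢ-comm (y +ᵢ w) x)
                     (≡.trans (*ᵢ-distribˡ x y w) (cong₂ _+ᵢ_ (*ᵢ-comm x y) (*ᵢ-comm x w)))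
    }
  ; *-comm = *ᵢ-comm
  }
  where
  open +-*-Solver
  *ᵢ-assoc : ∀ x y w → (x *ᵢ y) *ᵢ w ≡ x *ᵢ (y *ᵢ w)
  *ᵢ-assoc (a , b) (c , d) (e , f) = cong₂ _,_
    (solve 6 (λ a b c d e f → (a :* c :- b :* d) :* e :- (a :* d :+ b :* c) :* f :=
                              a :* (c :* e :- d :* f) :- b :* (c :* f :+ d :* e)) refl a b c d e f)
    (solve 6 (λ a b c d e f → (a :* c :- b :* d) :* f :+ (a :* d :+ b :* c) :* e :=
                              a :* (c :* f :+ d :* e) :+ b :* (c :* e :- d :* f)) refl a b c d e f)
  *ᵢ-comm : ∀ x y → x *ᵢ y ≡ y *ᵢ x
  *ᵢ-comm (a , b) (c , d) = cong₂ _,_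
    (solve 4 (λ a b c d → a :* c :- b :* d := c :* a :- d :* b) refl a b c d)
    (solve 4 (λ a b c d → a :* d :+ b :* c := c :* b :+ d :* a) refl a b c d)
  *ᵢ-identityˡ : ∀ x → ι 1ℚ *ᵢ x ≡ x
  *ᵢ-identityˡ (a , b) = cong₂ _,_
    (solve 2 (λ a b → con 1ℚ :* a :- con 0ℚ :* b := a) refl a b)
    (solve 2 (λ a b → con 1ℚ :* b :+ con 0ℚ :* a := b) refl a b)
  *ᵢ-distribˡ : ∀ x y w → x *ᵢ (y +ᵢ w) ≡ (x *ᵢ y) +ᵢ (x *ᵢ w)
  *ᵢ-distribˡ (a , b) (c , d) (e , f) = cong₂ _,_
    (solve 6 (λ a b c d e f → a :* (c :+ e) :- b :* (d :+ f) :=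
                              (a :* c :- b :* d) :+ (a :* e :- b :* f)) refl a b c d e f)
    (solve 6 (λ a b c d e f → a :* (d :+ f) :+ b :* (c :+ e) :=
                              (a :* d :+ b :* c) :+ (a :* f :+ b :* e)) refl a b c d e f)

ι-* : ∀ a b → ι (a ℚ.* b) ≡ ι a *ᵢ ι b
ι-* a b = cong₂ _,_
  (solve 2 (λ a b → a :* b := a :* b :- con 0ℚ :* con 0ℚ) refl a b)
  (solve 2 (λ a b → con 0ℚ := a :* con 0ℚ :+ con 0ℚ :* b) refl a b)
  where open +-*-Solver

module Q = PowerSeries ℚ-isCR
module QE = EulerProducts ℚ-isCR
module G = PowerSeries ℚ[i]-isCR
module GE = EulerProducts ℚ[i]-isCR

module At1  = LaurentEvaluation ℚ-isCR toℚ refl toℚ-neg toℚ-+ toℚ-* {1ℚ} {1ℚ} refl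
module At−1 = LaurentEvaluation ℚ-isCR toℚ refl toℚ-neg toℚ-+ toℚ-* {ℚ.- 1ℚ} {ℚ.- 1ℚ} refl
module At𝕚  = LaurentEvaluation ℚ[i]-isCR (ι ∘ toℚ) refl (λ a → cong ι (toℚ-neg a)) (λ a b → cong ι (toℚ-+ a b))
                (λ a b → ≡.trans (cong ι (toℚ-* a b)) (ι-* (toℚ a) (toℚ b))) {𝕚} { -ᵢ 𝕚} refl

module ι-map = MapSeries ℚ[i]-isCR ι refl refl (λ _ → refl) (λ _ _ → refl) ι-*

-- Residue classes of cranks modulo 4

-- The cases 4,…,7 make n ⊖ a compute for a ≤ 3, so that δ below is definitionally 4-periodic in both steps.
mod4-induction : (P : ℤ → Set) → P (+ 0) → P (+ 1) → P (+ 2) → P (+ 3) →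
                 P (+ 4) → P (+ 5) → P (+ 6) → P (+ 7) → (∀ k → P (+ (4 ℕ.+ k)) → P (+ (8 ℕ.+ k))) →
                 P -[1+ 0 ] → P -[1+ 1 ] → P -[1+ 2 ] → P -[1+ 3 ] → (∀ k → P -[1+ k ] → P -[1+ 4 ℕ.+ k ]) →
                 ∀ e → P e
mod4-induction P p0 p1 p2 p3 p4 p5 p6 p7 step n1 n2 n3 n4 step⁻ = λ { (+ n) → pos n ; -[1+ n ] → neg n }
  where
  pos : ∀ n → P (+ n)
  pos 0 = p0
  pos 1 = p1
  pos 2 = p2
  pos 3 = p3
  pos 4 = p4
  pos 5 = p5
  pos 6 = p6
  pos 7 = p7
  pos (suc (suc (suc (suc (suc (suc (suc (suc k)))))))) = step k (pos (suc (suc (suc (suc k)))))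
  neg : ∀ n → P -[1+ n ]
  neg 0 = n1
  neg 1 = n2
  neg 2 = n3
  neg 3 = n4
  neg (suc (suc (suc (suc k)))) = step⁻ k (neg k)

δ : ℤ → ℤ → ℚ
δ a e = if ⌊ (e ℤ.- a) %ℕ 4 ℕ.≟ 0 ⌋ then 1ℚ else 0ℚ

δ₀ δ₁ δ₂ δ₃ : ℤ → ℚ
δ₀ = δ (+ 0)
δ₁ = δ (+ 1)
δ₂ = δ (+ 2)
δ₃ = δ (+ 3)

module _ {A : Set} {_⊕_ _⊗_ : A → A → A} {⊖_ : A → A} {0# 1# : A}
         (isCR : IsCommutativeRing _≡_ _⊕_ _⊗_ ⊖_ 0# 1#) where
  open IsCommutativeRing isCR using (*-assoc; *-identityˡ)

  -- The periodicity step in the shape in which `powA` unfolds four times.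
  fourth-root-cancel : ∀ {x} → (x ⊗ x) ⊗ (x ⊗ x) ≡ 1# → ∀ y → x ⊗ (x ⊗ (x ⊗ (x ⊗ y))) ≡ y
  fourth-root-cancel {x} x⁴≡1 y = begin
    x ⊗ (x ⊗ (x ⊗ (x ⊗ y)))  ≡⟨ *-assoc x x _ ⟨
    (x ⊗ x) ⊗ (x ⊗ (x ⊗ y))  ≡⟨ cong ((x ⊗ x) ⊗_) (*-assoc x x y) ⟨
    (x ⊗ x) ⊗ ((x ⊗ x) ⊗ y)  ≡⟨ *-assoc (x ⊗ x) (x ⊗ x) y ⟨
    ((x ⊗ x) ⊗ (x ⊗ x)) ⊗ y  ≡⟨ cong (_⊗ y) x⁴≡1 ⟩
    1# ⊗ y                   ≡⟨ *-identityˡ y ⟩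
    y                        ∎
    where open ≡-Reasoning

-- Powers of a fourth root of unity x expand in the residue indicators with coefficients x^a, a = 0,
-- 1, 2, 3. Both sides are 4-periodic in e, so the base cases are settled by computation.
pow-1 : ∀ e → At1.pow e ≡ ((δ₀ e ℚ.+ δ₁ e) ℚ.+ δ₂ e) ℚ.+ δ₃ e
pow-1 = mod4-induction _ refl refl refl refl refl refl refl refl
  (λ k → ≡.trans (fourth-root-cancel ℚ-isCR {1ℚ} refl _)) refl refl refl refl
  (λ k → ≡.trans (fourth-root-cancel ℚ-isCR {1ℚ} refl _))

pow-−1 : ∀ e → At−1.pow e ≡ ((δ₀ e ℚ.- δ₁ e) ℚ.+ δ₂ e) ℚ.- δ₃ e
pow-−1 = mod4-induction _ refl refl refl refl refl refl refl refl
  (λ k → ≡.trans (fourth-root-cancel ℚ-isCR {ℚ.- 1ℚ} refl _)) refl refl refl refl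
  (λ k → ≡.trans (fourth-root-cancel ℚ-isCR {ℚ.- 1ℚ} refl _))

pow-𝕚 : ∀ e → At𝕚.pow e ≡ (δ₀ e ℚ.- δ₂ e , δ₁ e ℚ.- δ₃ e)
pow-𝕚 = mod4-induction _ refl refl refl refl refl refl refl refl
  (λ k → ≡.trans (fourth-root-cancel ℚ[i]-isCR {𝕚} refl _)) refl refl refl refl
  (λ k → ≡.trans (fourth-root-cancel ℚ[i]-isCR { -ᵢ 𝕚} refl _))

-- Common form of the two sides: evaluation is the weight of the powers, a residue class count is
-- the weight of an indicator. Linearity in w then carries character expansions over to crank
-- counts.
weight : (ℤ → ℚ) → LP → ℚ
weight w []            = 0ℚ
weight w ((e , c) ∷ p) = toℚ c ℚ.* w e ℚ.+ weight w p

-- `step` stands for the anonymous lambda folded by `Cmod`, which can only be described by its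
-- values.
weight-δ : ∀ a {step : ℤ × ℤ → ℤ → ℤ} →
           (∀ e c s → step (e , c) s ≡ (if ⌊ (e ℤ.- a) %ℕ 4 ℕ.≟ 0 ⌋ then c ℤ.+ s else s)) →
           ∀ p → toℚ (foldr step (+ 0) p) ≡ weight (δ a) p
weight-δ a step≡ []            = refl
weight-δ a {step} step≡ ((e , c) ∷ p) =
  ≡.trans (cong toℚ (step≡ e c _)) (case-if ⌊ (e ℤ.- a) %ℕ 4 ℕ.≟ 0 ⌋ (weight-δ a step≡ p))
  where
  case-if : ∀ b {s t} → toℚ s ≡ t → toℚ (if b then c ℤ.+ s else s) ≡ toℚ c ℚ.* (if b then 1ℚ else 0ℚ) ℚ.+ t
  case-if true  {s} refl = ≡.trans (toℚ-+ c s) (cong (ℚ._+ toℚ s) (≡.sym (ℚ.*-identityʳ (toℚ c))))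
  case-if false {s} refl = ≡.sym (≡.trans (cong (ℚ._+ toℚ s) (ℚ.*-zeroʳ (toℚ c))) (ℚ.+-identityˡ (toℚ s)))

c₀ c₁ c₂ c₃ : ℕ → ℚ
c₀ n = toℚ (Cmod (+ 0) 4 n)
c₁ n = toℚ (Cmod (+ 1) 4 n)
c₂ n = toℚ (Cmod (+ 2) 4 n)
c₃ n = toℚ (Cmod (+ 3) 4 n)

c≡weight : ∀ a n → toℚ (Cmod a 4 n) ≡ weight (δ a) (crankGF n)
c≡weight a n = weight-δ a (λ _ _ _ → refl) (crankGF n)

weight-cong : ∀ {v w} → (∀ e → v e ≡ w e) → ∀ p → weight v p ≡ weight w p
weight-cong v≡w []            = refl
weight-cong v≡w ((e , c) ∷ p) = cong₂ (λ x y → toℚ c ℚ.* x ℚ.+ y) (v≡w e) (weight-cong v≡w p)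

weight-+ : ∀ v w p → weight (λ e → v e ℚ.+ w e) p ≡ weight v p ℚ.+ weight w p
weight-+ v w []            = refl
weight-+ v w ((e , c) ∷ p) = ≡.trans (cong (toℚ c ℚ.* (v e ℚ.+ w e) ℚ.+_) (weight-+ v w p))
  (solve 5 (λ c x y s t → c :* (x :+ y) :+ (s :+ t) := (c :* x :+ s) :+ (c :* y :+ t)) refl
    (toℚ c) (v e) (w e) (weight v p) (weight w p))
  where open +-*-Solver

weight-− : ∀ v w p → weight (λ e → v e ℚ.- w e) p ≡ weight v p ℚ.- weight w p
weight-− v w []            = refl
weight-− v w ((e , c) ∷ p) = ≡.trans (cong (toℚ c ℚ.* (v e ℚ.- w e) ℚ.+_) (weight-− v w p))
  (solve 5 (λ c x y s t → c :* (x :- y) :+ (s :- t) := (c :* x :+ s) :- (c :* y :+ t)) refl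
    (toℚ c) (v e) (w e) (weight v p) (weight w p))
  where open +-*-Solver

eval-1 : ∀ p → At1.eval p ≡ ((weight δ₀ p ℚ.+ weight δ₁ p) ℚ.+ weight δ₂ p) ℚ.+ weight δ₃ p
eval-1 p = begin
  At1.eval p                                                        ≡⟨ eval-weight p ⟩
  weight At1.pow p                                                  ≡⟨ weight-cong pow-1 p ⟩
  weight (λ e → ((δ₀ e ℚ.+ δ₁ e) ℚ.+ δ₂ e) ℚ.+ δ₃ e) p              ≡⟨ weight-+ _ δ₃ p ⟩
  weight (λ e → (δ₀ e ℚ.+ δ₁ e) ℚ.+ δ₂ e) p ℚ.+ weight δ₃ p         ≡⟨ cong (ℚ._+ weight δ₃ p) (weight-+ _ δ₂ p) ⟩
  (weight (λ e → δ₀ e ℚ.+ δ₁ e) p ℚ.+ weight δ₂ p) ℚ.+ weight δ₃ p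
    ≡⟨ cong (λ s → (s ℚ.+ weight δ₂ p) ℚ.+ weight δ₃ p) (weight-+ δ₀ δ₁ p) ⟩
  ((weight δ₀ p ℚ.+ weight δ₁ p) ℚ.+ weight δ₂ p) ℚ.+ weight δ₃ p   ∎
  where
  open ≡-Reasoning
  eval-weight : ∀ p → At1.eval p ≡ weight At1.pow p
  eval-weight []            = refl
  eval-weight ((e , c) ∷ p) = cong (toℚ c ℚ.* At1.pow e ℚ.+_) (eval-weight p)

eval-−1 : ∀ p → At−1.eval p ≡ ((weight δ₀ p ℚ.- weight δ₁ p) ℚ.+ weight δ₂ p) ℚ.- weight δ₃ p
eval-−1 p = begin
  At−1.eval p                                                       ≡⟨ eval-weight p ⟩
  weight At−1.pow p                                                 ≡⟨ weight-cong pow-−1 p ⟩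
  weight (λ e → ((δ₀ e ℚ.- δ₁ e) ℚ.+ δ₂ e) ℚ.- δ₃ e) p              ≡⟨ weight-− _ δ₃ p ⟩
  weight (λ e → (δ₀ e ℚ.- δ₁ e) ℚ.+ δ₂ e) p ℚ.- weight δ₃ p         ≡⟨ cong (ℚ._- weight δ₃ p) (weight-+ _ δ₂ p) ⟩
  (weight (λ e → δ₀ e ℚ.- δ₁ e) p ℚ.+ weight δ₂ p) ℚ.- weight δ₃ p
    ≡⟨ cong (λ s → (s ℚ.+ weight δ₂ p) ℚ.- weight δ₃ p) (weight-− δ₀ δ₁ p) ⟩
  ((weight δ₀ p ℚ.- weight δ₁ p) ℚ.+ weight δ₂ p) ℚ.- weight δ₃ p   ∎
  where
  open ≡-Reasoning
  eval-weight : ∀ p → At−1.eval p ≡ weight At−1.pow p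
  eval-weight []            = refl
  eval-weight ((e , c) ∷ p) = cong (toℚ c ℚ.* At−1.pow e ℚ.+_) (eval-weight p)

eval-𝕚 : ∀ p → At𝕚.eval p ≡ (weight δ₀ p ℚ.- weight δ₂ p , weight δ₁ p ℚ.- weight δ₃ p)
eval-𝕚 p = begin
  At𝕚.eval p
    ≡⟨ eval-weight p ⟩
  (weight (proj₁ ∘ At𝕚.pow) p , weight (proj₂ ∘ At𝕚.pow) p)
    ≡⟨ cong₂ _,_ (weight-cong (λ e → cong proj₁ (pow-𝕚 e)) p) (weight-cong (λ e → cong proj₂ (pow-𝕚 e)) p) ⟩
  (weight (λ e → δ₀ e ℚ.- δ₂ e) p , weight (λ e → δ₁ e ℚ.- δ₃ e) p)
    ≡⟨ cong₂ _,_ (weight-− δ₀ δ₂ p) (weight-− δ₁ δ₃ p) ⟩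
  (weight δ₀ p ℚ.- weight δ₂ p , weight δ₁ p ℚ.- weight δ₃ p) ∎
  where
  open ≡-Reasoning
  ι-scale : ∀ a x → ι a *ᵢ x ≡ (a ℚ.* proj₁ x , a ℚ.* proj₂ x)
  ι-scale a (u , v) = cong₂ _,_
    (≡.trans (cong (λ t → a ℚ.* u ℚ.+ ℚ.- t) (ℚ.*-zeroˡ v)) (ℚ.+-identityʳ _))
    (≡.trans (cong (a ℚ.* v ℚ.+_) (ℚ.*-zeroˡ u)) (ℚ.+-identityʳ _))
  eval-weight : ∀ p → At𝕚.eval p ≡ (weight (proj₁ ∘ At𝕚.pow) p , weight (proj₂ ∘ At𝕚.pow) p)
  eval-weight []            = refl
  eval-weight ((e , c) ∷ p) = cong₂ _+ᵢ_ (ι-scale (toℚ c) (At𝕚.pow e)) (eval-weight p)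

-- Partitions

module PartitionGF where
  open Q
  open JacobiTriple ℚ-isCR using (partialProd; prodUpTo-partialProd)

  boundedGF : ℕ → Series
  boundedGF = partialProd (geom 1ℚ)

  -- (1 - q^(k+1)) cancels the last factor: removing one part k + 1 relates parts at most k + 1 to
  -- parts at most k.
  boundedGF-rec : ∀ k n → boundedGF (suc k) n ℚ.+ (mono (ℚ.- 1ℚ) (suc k) * boundedGF (suc k)) n ≡ boundedGF k n
  boundedGF-rec k n = ≡.trans (≡.sym (+-def _ _ n)) (at series-rec n)
    where
    open SetoidReasoning S.setoid
    series-rec : boundedGF (suc k) + mono (ℚ.- 1ℚ) (suc k) * boundedGF (suc k) ≈ boundedGF k
    series-rec = begin
      boundedGF (suc k) + mono (ℚ.- 1ℚ) (suc k) * boundedGF (suc k)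
        ≈⟨ S.+-cong (S.*-identityʳ _) (S.*-comm _ _) ⟨
      boundedGF (suc k) * oneₛ + boundedGF (suc k) * mono (ℚ.- 1ℚ) (suc k)
        ≈⟨ S.distribˡ _ _ _ ⟨
      (boundedGF k * geom 1ℚ k) * binomial (ℚ.- 1ℚ) (suc k)
        ≈⟨ S.*-assoc _ _ _ ⟩
      boundedGF k * (geom 1ℚ k * binomial (ℚ.- 1ℚ) (suc k))
        ≈⟨ S.*-congˡ (geom-inverse 1ℚ k) ⟩
      boundedGF k * oneₛ
        ≈⟨ S.*-identityʳ _ ⟩
      boundedGF k ∎

  boundedGF-< : ∀ {k n} → n ≤ k → boundedGF (suc k) n ≡ boundedGF k n
  boundedGF-< {k} {n} n≤k = ≡.trans (≡.sym (≡.trans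
    (cong (boundedGF (suc k) n ℚ.+_) (mono-*-< (ℚ.- 1ℚ) (boundedGF (suc k)) (s≤s n≤k))) (ℚ.+-identityʳ _)))
    (boundedGF-rec k n)

  boundedGF-≥ : ∀ k r → boundedGF (suc k) (suc k ℕ.+ r) ≡ boundedGF k (suc k ℕ.+ r) ℚ.+ boundedGF (suc k) r
  boundedGF-≥ k r = transpose (boundedGF-rec k (suc k ℕ.+ r)) (mono-*-+ (ℚ.- 1ℚ) (suc k) (boundedGF (suc k)) r)
    where
    open +-*-Solver
    transpose : ∀ {x y w b} → x ℚ.+ w ≡ b → w ≡ ℚ.- 1ℚ ℚ.* y → x ≡ b ℚ.+ y
    transpose {x} {y} refl refl = solve 2 (λ x y → x := (x :+ con (ℚ.- 1ℚ) :* y) :+ y) refl x y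

  boundedGF-stable : ∀ d n → boundedGF (d ℕ.+ n) n ≡ boundedGF n n
  boundedGF-stable zero    n = refl
  boundedGF-stable (suc d) n = ≡.trans (boundedGF-< (ℕ.m≤n+m n d)) (boundedGF-stable d n)

  -- Matches the cap on the largest part in `partsF`: part sizes above n do not affect the
  -- coefficient of q^n.
  boundedGF-⊓ : ∀ k n → boundedGF (k ℕ.⊓ n) n ≡ boundedGF k n
  boundedGF-⊓ k n with ℕ.≤-total k n
  ... | inj₁ k≤n rewrite ℕ.m≤n⇒m⊓n≡m k≤n = refl
  ... | inj₂ n≤k rewrite ℕ.m≥n⇒m⊓n≡n n≤k with ℕ.m≤n⇒∃[o]m+o≡n n≤k
  ...   | d , refl = ≡.trans (≡.sym (boundedGF-stable d n)) (cong (λ k → boundedGF k n) (ℕ.+-comm d n))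

  count : List (List ℕ) → ℚ
  count ps = toℚ (+ length ps)

  count-++ : ∀ ps qs → count (ps ++ qs) ≡ count ps ℚ.+ count qs
  count-++ ps qs = ≡.trans (cong (λ l → toℚ (+ l)) (length-++ ps)) (toℚ-+ (+ length ps) (+ length qs))

  -- Sorting by the largest part 1 + j gives the telescoped recursion of boundedGF.
  count-largest : ∀ (parts : ℕ → List (List ℕ)) n →
                  (∀ j → j ≤ n → count (parts j) ≡ boundedGF (suc j) (n ∸ j)) →
                  ∀ k → k ≤ suc n → count (concatMap parts (upTo k)) ≡ boundedGF k (suc n)
  count-largest parts n parts≡ zero    _           = refl
  count-largest parts n parts≡ (suc k) (s≤s k≤n) = begin
    count (concatMap parts (upTo (suc k)))
      ≡⟨ cong (count ∘ concatMap parts) (upTo-∷ʳ k) ⟨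
    count (concatMap parts (upTo k ++ k ∷ []))
      ≡⟨ cong count (≡.trans (concatMap-++ parts (upTo k) (k ∷ [])) (cong (concatMap parts (upTo k) ++_) (++-identityʳ (parts k)))) ⟩
    count (concatMap parts (upTo k) ++ parts k)
      ≡⟨ count-++ (concatMap parts (upTo k)) (parts k) ⟩
    count (concatMap parts (upTo k)) ℚ.+ count (parts k)
      ≡⟨ cong₂ ℚ._+_ (count-largest parts n parts≡ k (ℕ.m≤n⇒m≤1+n k≤n)) (parts≡ k k≤n) ⟩
    boundedGF k (suc n) ℚ.+ boundedGF (suc k) (n ∸ k)
      ≡⟨ cong (λ n′ → boundedGF k (suc n′) ℚ.+ boundedGF (suc k) (n ∸ k)) (ℕ.m+[n∸m]≡n k≤n) ⟨
    boundedGF k (suc k ℕ.+ (n ∸ k)) ℚ.+ boundedGF (suc k) (n ∸ k)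
      ≡⟨ boundedGF-≥ k (n ∸ k) ⟨
    boundedGF (suc k) (suc k ℕ.+ (n ∸ k))
      ≡⟨ cong (λ n′ → boundedGF (suc k) (suc n′)) (ℕ.m+[n∸m]≡n k≤n) ⟩
    boundedGF (suc k) (suc n) ∎
    where open ≡-Reasoning

  count-partsF : ∀ f n k → n ≤ f → count (partsF f n k) ≡ boundedGF k n
  count-partsF f       zero    zero    _         = refl
  count-partsF f       zero    (suc k) n≤f       = ≡.trans (count-partsF f zero k n≤f) (≡.sym (boundedGF-< z≤n))
  count-partsF (suc f) (suc n) k       (s≤s n≤f) = ≡.trans
    (count-largest (λ j → map (suc j ∷_) (partsF f (n ∸ j) (suc j))) n
      (λ j _ → ≡.trans (cong (λ l → toℚ (+ l)) (length-map (suc j ∷_) (partsF f (n ∸ j) (suc j))))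
                       (count-partsF f (n ∸ j) (suc j) (ℕ.≤-trans (ℕ.m∸n≤m n j) n≤f)))
      (k ℕ.⊓ suc n) (ℕ.m⊓n≤n k (suc n)))
    (boundedGF-⊓ k (suc n))

  p-gf : ∀ n → toℚ (+ p n) ≡ QE.geoms 1ℚ 0 1 n
  -- The n-th coefficient of `infProd` uses n + 1 factors, that is parts up to n + 1; the surplus
  -- part size is harmless.
  p-gf n = ≡.trans (count-partsF n n n ℕ.≤-refl) (≡.trans (≡.sym (boundedGF-stable 1 n))
    (≡.sym (at (S.trans (QE.geoms-0-1 1ℚ) (ptwise λ n → at (prodUpTo-partialProd (geom 1ℚ) n) n)) n)))

-- The four theta products and the crank values expanded in them

module ThetaCombination {A : Set} {_⊕_ _⊗_ : A → A → A} {⊖_ : A → A} {0# 1# : A}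
                        (isCR : IsCommutativeRing _≡_ _⊕_ _⊗_ ⊖_ 0# 1#) where

  open PowerSeries isCR
  open EulerProducts isCR
  open JacobiTriple isCR using (mono-≡)
  open SemiringSolver series using (_:+_; _:*_) renaming (solve to solveₛ)

  private
    module A where
      open CommutativeRing coefficients public
      open RingProperties ring public

  -- bar and ϑ unfold at ℚ to Jbar and ϑ₄; over an abstract ring no rational arithmetic can be triggered.
  bar : ℕ → ℕ → Series
  bar a m = (poch (⊖ 1#) a m *ₛ poch (⊖ 1#) (m ∸ a) m) *ₛ poch 1# m m

  ϑ : A → A → A → A → A → Series
  ϑ k a₀ a₁ a₂ a₃ = scaleₛ k (infProd (λ i → geom 1# (4 ℕ.* suc i ∸ 1)) *ₛ
    (((scaleₛ a₀ (bar 4 8 *ₛ bar 6 16)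
    +ₛ scaleₛ a₁ (shiftₛ 2 (bar 0 8 *ₛ bar 14 16)))
    +ₛ scaleₛ a₂ (shiftₛ 1 (bar 4 8 *ₛ bar 14 16)))
    +ₛ scaleₛ a₃ (shiftₛ 1 (bar 0 8 *ₛ bar 6 16))))

  private
    α β γ ε q q² J₄⁻¹ : Series
    α = thetaBar 4 4 8
    β = thetaBar 0 8 8
    γ = thetaBar 6 10 16
    ε = thetaBar 14 2 16
    q = mono 1# 1
    q² = mono 1# 2
    J₄⁻¹ = geoms 1# 3 4

  V₀ V₁ V₂ V₃ : Series
  V₀ = J₄⁻¹ * (α * γ)
  V₁ = J₄⁻¹ * (q² * (β * ε))
  V₂ = J₄⁻¹ * (q * (α * ε))
  V₃ = J₄⁻¹ * (q * (β * γ))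

  *ₛ-cong : ∀ {f f′ g g′} → f ≈ f′ → g ≈ g′ → f *ₛ g ≈ f′ * g′
  *ₛ-cong {f} {g = g} f≈f′ g≈g′ = S.trans (*-def f g) (S.*-cong f≈f′ g≈g′)

  +ₛ-cong : ∀ {f f′ g g′} → f ≈ f′ → g ≈ g′ → f +ₛ g ≈ f′ + g′
  +ₛ-cong {f} {g = g} f≈f′ g≈g′ = S.trans (+ₛ-def f g) (S.+-cong f≈f′ g≈g′)

  scaleₛ-cong : ∀ c {f f′} → f ≈ f′ → scaleₛ c f ≈ constₛ c * f′
  scaleₛ-cong c {f} f≈f′ = S.trans (scaleₛ-def c f) (S.*-congˡ f≈f′)

  bar-theta : ∀ a m → bar a m ≈ thetaBar a (m ∸ a) m
  bar-theta a m = *ₛ-cong (*-def (poch (⊖ 1#) a m) (poch (⊖ 1#) (m ∸ a) m)) (S.refl {poch 1# m m})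

  ϑ-coeff : ∀ k a₀ a₁ a₂ a₃ n → ϑ k a₀ a₁ a₂ a₃ n ≡
            k ⊗ ((((a₀ ⊗ V₀ n) ⊕ (a₁ ⊗ V₁ n)) ⊕ (a₂ ⊗ V₂ n)) ⊕ (a₃ ⊗ V₃ n))
  ϑ-coeff k a₀ a₁ a₂ a₃ n = cong (k ⊗_) (≡.trans (at expand n) coefficient)
    where
    c : A → Series
    c = constₛ
    J₄⁻¹-geoms : infProd (λ i → geom 1# (4 ℕ.* suc i ∸ 1)) ≈ J₄⁻¹
    J₄⁻¹-geoms = infProd-cong λ i → S.reflexive (cong (geom 1#) (exponent i))
      where
      exponent : ∀ i → i ℕ.+ 3 ℕ.* suc i ≡ 3 ℕ.+ 4 ℕ.* i
      exponent i = ℕ-solve (i ∷ [])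
    shifted : ∀ a e {f f′ g g′} → f ≈ f′ → g ≈ g′ → scaleₛ a (shiftₛ e (f *ₛ g)) ≈ c a * (mono 1# e * (f′ * g′))
    shifted a e f≈f′ g≈g′ = scaleₛ-cong a (*ₛ-cong (S.refl {mono 1# e}) (*ₛ-cong f≈f′ g≈g′))
    expand : _ ≈ ((c a₀ * V₀ + c a₁ * V₁) + c a₂ * V₂) + c a₃ * V₃
    expand = S.trans
      (*ₛ-cong J₄⁻¹-geoms (+ₛ-cong (+ₛ-cong (+ₛ-cong
        (scaleₛ-cong a₀ (*ₛ-cong (bar-theta 4 8) (bar-theta 6 16)))
        (shifted a₁ 2 (bar-theta 0 8) (bar-theta 14 16)))
        (shifted a₂ 1 (bar-theta 4 8) (bar-theta 14 16)))
        (shifted a₃ 1 (bar-theta 0 8) (bar-theta 6 16))))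
      (solveₛ 9 (λ j a b c d x y u v →
          j :* (((a :* x :+ b :* y) :+ c :* u) :+ d :* v) ,
          ((a :* (j :* x) :+ b :* (j :* y)) :+ c :* (j :* u)) :+ d :* (j :* v)) S.refl
        J₄⁻¹ (c a₀) (c a₁) (c a₂) (c a₃) (α * γ) (q² * (β * ε)) (q * (α * ε)) (q * (β * γ)))
    coefficient : (((c a₀ * V₀ + c a₁ * V₁) + c a₂ * V₂) + c a₃ * V₃) n ≡
                  ((((a₀ ⊗ V₀ n) ⊕ (a₁ ⊗ V₁ n)) ⊕ (a₂ ⊗ V₂ n)) ⊕ (a₃ ⊗ V₃ n))
    coefficient = ≡.trans (+-def _ _ n) (cong₂ _⊕_ (≡.trans (+-def _ _ n) (cong₂ _⊕_ (≡.trans (+-def _ _ n)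
      (cong₂ _⊕_ (constₛ-* a₀ V₀ n) (constₛ-* a₁ V₁ n))) (constₛ-* a₂ V₂ n))) (constₛ-* a₃ V₃ n))

  private
    -- The signed monomials ±q are hidden in r and s, because the semiring solver has no negation.
    -- Their product r s becomes ±q², which yields the q² of the second product in `ϑ`.
    expand-φψ : ∀ r s → J₄⁻¹ * ((α + r * β) * (γ + s * ε)) ≈
                J₄⁻¹ * (α * γ) + (J₄⁻¹ * ((r * s) * (β * ε)) + (J₄⁻¹ * (s * (α * ε)) + J₄⁻¹ * (r * (β * γ))))
    expand-φψ r s = solveₛ 7 (λ j a b c e r s →
        j :* ((a :+ r :* b) :* (c :+ s :* e)) ,
        j :* (a :* c) :+ (j :* ((r :* s) :* (b :* e)) :+ (j :* (s :* (a :* e)) :+ j :* (r :* (b :* c))))) S.refl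
      J₄⁻¹ α β γ ε r s

    constₛ-mono : ∀ c d e → mono (c ⊗ d) e ≈ constₛ c * mono d e
    constₛ-mono c d e = S.trans (S.sym (mono-* c 0 d e)) (S.*-congʳ (mono-0 c))

    negate : ∀ {c d e} → c ≡ (⊖ 1#) ⊗ d → ∀ f n → (J₄⁻¹ * (mono c e * f)) n ≡ (⊖ 1#) ⊗ (J₄⁻¹ * (mono d e * f)) n
    negate {c} {d} {e} refl f n = ≡.trans (at (S.trans
      (S.*-congˡ (S.*-congʳ (constₛ-mono (⊖ 1#) d e)))
      (solveₛ 4 (λ j k m f → j :* ((k :* m) :* f) , k :* (j :* (m :* f))) S.refl J₄⁻¹ (constₛ (⊖ 1#)) (mono d e) f)) n)
      (constₛ-* (⊖ 1#) _ n)

    -1≡-1*1 : ⊖ 1# ≡ (⊖ 1#) ⊗ 1#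
    -1≡-1*1 = ≡.sym (A.*-identityʳ _)

    -1*-1≡1 : (⊖ 1#) ⊗ (⊖ 1#) ≡ 1#
    -1*-1≡1 = ≡.trans (A.-1*x≈-x _) (A.-‿involutive 1#)

    sum₄ : ∀ {f g h k : Series} {n a b c d} → f n ≡ a → g n ≡ b → h n ≡ c → k n ≡ d →
           (f + (g + (h + k))) n ≡ a ⊕ (b ⊕ (c ⊕ d))
    sum₄ {n = n} refl refl refl refl =
      ≡.trans (+-def _ _ n) (cong (_ ⊕_) (≡.trans (+-def _ _ n) (cong (_ ⊕_) (+-def _ _ n))))

  crank-−1-coeff : ∀ n → crankAt (⊖ 1#) (⊖ 1#) n ≡ V₀ n ⊕ (V₁ n ⊕ (((⊖ 1#) ⊗ V₂ n) ⊕ ((⊖ 1#) ⊗ V₃ n)))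
  crank-−1-coeff n = ≡.trans
    (at (S.trans crankAt-−1 (S.trans (S.sym (φψ -1*-1≡1)) (expand-φψ (mono (⊖ 1#) 1) (mono (⊖ 1#) 1)))) n)
    (sum₄ refl
      (at (S.*-congˡ (S.*-congʳ (S.trans (mono-* (⊖ 1#) 1 (⊖ 1#) 1) (mono-≡ -1*-1≡1 refl)))) n)
      (negate -1≡-1*1 (α * ε) n) (negate -1≡-1*1 (β * γ) n))

  -- Stated for the product form instead of `crankAt`, so that it can be used over ℚ, where no
  -- square root of -1 exists.
  crank-i-coeff : ∀ n → (poch 1# 1 1 * (D * Nₒ)) n ≡ V₀ n ⊕ (((⊖ 1#) ⊗ V₁ n) ⊕ (V₂ n ⊕ ((⊖ 1#) ⊗ V₃ n)))
  crank-i-coeff n = ≡.trans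
    (at (S.trans (S.sym (φψ ⊖⊖1²≡1)) (S.trans
      (S.*-congˡ (S.*-congˡ (S.+-congˡ (S.*-congʳ (mono-≡ (A.-‿involutive 1#) refl)))))
      (expand-φψ (mono (⊖ 1#) 1) q))) n)
    (sum₄ refl
      (≡.trans (at (S.*-congˡ (S.*-congʳ (mono-* (⊖ 1#) 1 1# 1))) n) (negate refl (β * ε) n))
      refl (negate -1≡-1*1 (β * γ) n))
    where
    ⊖⊖1²≡1 : (⊖ (⊖ 1#)) ⊗ (⊖ (⊖ 1#)) ≡ 1#
    ⊖⊖1²≡1 = ≡.trans (cong₂ _⊗_ (A.-‿involutive 1#) (A.-‿involutive 1#)) (A.*-identityˡ 1#)

-- Coefficient identities over ℚ and the linear algebra

module QT = ThetaCombination ℚ-isCR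

V₀ V₁ V₂ V₃ : ℕ → ℚ
V₀ = QT.V₀
V₁ = QT.V₁
V₂ = QT.V₂
V₃ = QT.V₃

partition-identity : ∀ n → ((c₀ n ℚ.+ c₁ n) ℚ.+ c₂ n) ℚ.+ c₃ n ≡ toℚ (+ p n)
partition-identity n = begin
  ((c₀ n ℚ.+ c₁ n) ℚ.+ c₂ n) ℚ.+ c₃ n
    ≡⟨ cong₂ ℚ._+_ (cong₂ ℚ._+_ (cong₂ ℚ._+_ (c≡weight (+ 0) n) (c≡weight (+ 1) n)) (c≡weight (+ 2) n)) (c≡weight (+ 3) n) ⟩
  _                             ≡⟨ eval-1 (crankGF n) ⟨
  At1.eval (crankGF n)          ≡⟨ Q.at At1.eval-crankGF n ⟩
  QE.crankAt 1ℚ 1ℚ n            ≡⟨ Q.at QE.crankAt-1 n ⟩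
  QE.geoms 1ℚ 0 1 n             ≡⟨ PartitionGF.p-gf n ⟨
  toℚ (+ p n)                   ∎
  where open ≡-Reasoning

alternating-identity : ∀ n → ((c₀ n ℚ.- c₁ n) ℚ.+ c₂ n) ℚ.- c₃ n ≡
                       V₀ n ℚ.+ (V₁ n ℚ.+ (ℚ.- 1ℚ ℚ.* V₂ n ℚ.+ ℚ.- 1ℚ ℚ.* V₃ n))
alternating-identity n = begin
  ((c₀ n ℚ.- c₁ n) ℚ.+ c₂ n) ℚ.- c₃ n
    ≡⟨ cong₂ ℚ._-_ (cong₂ ℚ._+_ (cong₂ ℚ._-_ (c≡weight (+ 0) n) (c≡weight (+ 1) n)) (c≡weight (+ 2) n)) (c≡weight (+ 3) n) ⟩
  _                                  ≡⟨ eval-−1 (crankGF n) ⟨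
  At−1.eval (crankGF n)              ≡⟨ Q.at At−1.eval-crankGF n ⟩
  QE.crankAt (ℚ.- 1ℚ) (ℚ.- 1ℚ) n     ≡⟨ QT.crank-−1-coeff n ⟩
  _                                  ∎
  where open ≡-Reasoning

-- Descent from ℚ[i]: the three products making up the value at i have coefficients ±1 in their
-- factors, so they are images under ι of series over ℚ.
ι-crank : ι ∘ (Q.poch 1ℚ 1 1 Q.* (QE.D Q.* QE.Nₒ)) G.≈ GE.crankAt 𝕚 (-ᵢ 𝕚)
ι-crank = begin
  ι ∘ (Q.poch 1ℚ 1 1 Q.* (QE.D Q.* QE.Nₒ))
    ≈⟨ map-* (Q.poch 1ℚ 1 1) (QE.D Q.* QE.Nₒ) ⟩
  (ι ∘ Q.poch 1ℚ 1 1) G.* (ι ∘ (QE.D Q.* QE.Nₒ))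
    ≈⟨ G.S.*-cong (ι-map.map-poch 1ℚ refl 1 1) (G.S.trans (map-* QE.D QE.Nₒ)
         (G.S.*-cong (ι-map.map-poch 1ℚ refl 1 2) (ι-map.map-poch (ℚ.- 1ℚ) refl 1 2))) ⟩
  G.poch (ι 1ℚ) 1 1 G.* (GE.D G.* GE.Nₒ)
    ≈⟨ GE.crankAt-i refl ⟨
  GE.crankAt 𝕚 (-ᵢ 𝕚) ∎
  where
  open SetoidReasoning G.S.setoid
  map-* : ∀ f g → ι ∘ (f Q.* g) G.≈ (ι ∘ f) G.* (ι ∘ g)
  map-* f g = G.S.trans (G.ptwise λ n → cong ι (≡.sym (Q.at (Q.*-def f g) n))) (ι-map.map-*ₛ f g)

gaussian-identity : ∀ n → (c₀ n ℚ.- c₂ n , c₁ n ℚ.- c₃ n) ≡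
                    ι (V₀ n ℚ.+ (ℚ.- 1ℚ ℚ.* V₁ n ℚ.+ (V₂ n ℚ.+ ℚ.- 1ℚ ℚ.* V₃ n)))
gaussian-identity n = begin
  (c₀ n ℚ.- c₂ n , c₁ n ℚ.- c₃ n)
    ≡⟨ cong₂ _,_ (cong₂ ℚ._-_ (c≡weight (+ 0) n) (c≡weight (+ 2) n)) (cong₂ ℚ._-_ (c≡weight (+ 1) n) (c≡weight (+ 3) n)) ⟩
  _                                             ≡⟨ eval-𝕚 (crankGF n) ⟨
  At𝕚.eval (crankGF n)                          ≡⟨ G.at At𝕚.eval-crankGF n ⟩
  GE.crankAt 𝕚 (-ᵢ 𝕚) n                         ≡⟨ G.at ι-crank n ⟨
  ι ((Q.poch 1ℚ 1 1 Q.* (QE.D Q.* QE.Nₒ)) n)    ≡⟨ cong ι (QT.crank-i-coeff n) ⟩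
  _                                             ∎
  where open ≡-Reasoning

-- The right side of `gaussian-identity` lies in the image of ι, so its imaginary part c₁ - c₃ is 0.
c₁≡c₃ : ∀ n → c₁ n ≡ c₃ n
c₁≡c₃ n = begin
  c₁ n                       ≡⟨ solve 2 (λ x y → x := (x :- y) :+ y) refl (c₁ n) (c₃ n) ⟩
  (c₁ n ℚ.- c₃ n) ℚ.+ c₃ n   ≡⟨ cong (ℚ._+ c₃ n) (cong proj₂ (gaussian-identity n)) ⟩
  0ℚ ℚ.+ c₃ n                ≡⟨ ℚ.+-identityˡ (c₃ n) ⟩
  c₃ n                       ∎
  where
  open ≡-Reasoning
  open +-*-Solver

private
  ¼ : ℚ
  ¼ = + 1 ℚ./ 4

  -- Replacing p(n) by the sum of the four classes makes the deviation a linear form in c₀, c₁, c₂,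
  -- c₃ alone.
  D_C-coeff : ∀ a n → D_C a 4 n ≡ toℚ (Cmod a 4 n) ℚ.- (((c₀ n ℚ.+ c₁ n) ℚ.+ c₂ n) ℚ.+ c₃ n) ℚ.* ¼
  D_C-coeff a n = cong (λ x → toℚ (Cmod a 4 n) ℚ.- x)
    (≡.trans (/4≡toℚ*¼ (+ p n)) (cong (ℚ._* ¼) (≡.sym (partition-identity n))))

D_C-0 : ∀ n → D_C (+ 0) 4 n ≡ ϑ₄ (+ 3) (ℤ.- + 1) (+ 1) (ℤ.- + 3) n
D_C-0 n = begin
  D_C (+ 0) 4 n
    ≡⟨ D_C-coeff (+ 0) n ⟩
  c₀ n ℚ.- (((c₀ n ℚ.+ c₁ n) ℚ.+ c₂ n) ℚ.+ c₃ n) ℚ.* ¼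
    -- 4 c₀ - P = B + 2A. In the four products this is (1, 1, -1, -1) + 2 (1, -1, 1, -1) = (3, -1,
    -- 1, -3).
    ≡⟨ solve 4 (λ x y u v → x :- (((x :+ y) :+ u) :+ v) :* con ¼ :=
                 con ¼ :* ((((x :- y) :+ u) :- v) :+ con (toℚ (+ 2)) :* (x :- u))) refl (c₀ n) (c₁ n) (c₂ n) (c₃ n) ⟩
  ¼ ℚ.* ((((c₀ n ℚ.- c₁ n) ℚ.+ c₂ n) ℚ.- c₃ n) ℚ.+ toℚ (+ 2) ℚ.* (c₀ n ℚ.- c₂ n))
    ≡⟨ cong₂ (λ s t → ¼ ℚ.* (s ℚ.+ toℚ (+ 2) ℚ.* t)) (alternating-identity n) (cong proj₁ (gaussian-identity n)) ⟩
  ¼ ℚ.* ((V₀ n ℚ.+ (V₁ n ℚ.+ (ℚ.- 1ℚ ℚ.* V₂ n ℚ.+ ℚ.- 1ℚ ℚ.* V₃ n))) ℚ.+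
         toℚ (+ 2) ℚ.* (V₀ n ℚ.+ (ℚ.- 1ℚ ℚ.* V₁ n ℚ.+ (V₂ n ℚ.+ ℚ.- 1ℚ ℚ.* V₃ n))))
    ≡⟨ cong (¼ ℚ.*_) (solve 4 (λ x y u v →
         (x :+ (y :+ (con (ℚ.- 1ℚ) :* u :+ con (ℚ.- 1ℚ) :* v))) :+
         con (toℚ (+ 2)) :* (x :+ (con (ℚ.- 1ℚ) :* y :+ (u :+ con (ℚ.- 1ℚ) :* v))) :=
         ((con (toℚ (+ 3)) :* x :+ con (ℚ.- 1ℚ) :* y) :+ con 1ℚ :* u) :+ con (toℚ (ℤ.- + 3)) :* v) refl
         (V₀ n) (V₁ n) (V₂ n) (V₃ n)) ⟩
  ¼ ℚ.* (((toℚ (+ 3) ℚ.* V₀ n ℚ.+ toℚ (ℤ.- + 1) ℚ.* V₁ n) ℚ.+ toℚ (+ 1) ℚ.* V₂ n) ℚ.+ toℚ (ℤ.- + 3) ℚ.* V₃ n)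
    ≡⟨ QT.ϑ-coeff ¼ (toℚ (+ 3)) (toℚ (ℤ.- + 1)) (toℚ (+ 1)) (toℚ (ℤ.- + 3)) n ⟨
  ϑ₄ (+ 3) (ℤ.- + 1) (+ 1) (ℤ.- + 3) n ∎
  where
  open ≡-Reasoning
  open +-*-Solver

D_C-2 : ∀ n → D_C (+ 2) 4 n ≡ ϑ₄ (ℤ.- + 1) (+ 3) (ℤ.- + 3) (+ 1) n
D_C-2 n = begin
  D_C (+ 2) 4 n
    ≡⟨ D_C-coeff (+ 2) n ⟩
  c₂ n ℚ.- (((c₀ n ℚ.+ c₁ n) ℚ.+ c₂ n) ℚ.+ c₃ n) ℚ.* ¼
    -- 4 c₂ - P = B - 2A, that is (1, 1, -1, -1) - 2 (1, -1, 1, -1) = (-1, 3, -3, 1).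
    ≡⟨ solve 4 (λ x y u v → u :- (((x :+ y) :+ u) :+ v) :* con ¼ :=
                 con ¼ :* ((((x :- y) :+ u) :- v) :- con (toℚ (+ 2)) :* (x :- u))) refl (c₀ n) (c₁ n) (c₂ n) (c₃ n) ⟩
  ¼ ℚ.* ((((c₀ n ℚ.- c₁ n) ℚ.+ c₂ n) ℚ.- c₃ n) ℚ.- toℚ (+ 2) ℚ.* (c₀ n ℚ.- c₂ n))
    ≡⟨ cong₂ (λ s t → ¼ ℚ.* (s ℚ.- toℚ (+ 2) ℚ.* t)) (alternating-identity n) (cong proj₁ (gaussian-identity n)) ⟩
  ¼ ℚ.* ((V₀ n ℚ.+ (V₁ n ℚ.+ (ℚ.- 1ℚ ℚ.* V₂ n ℚ.+ ℚ.- 1ℚ ℚ.* V₃ n))) ℚ.-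
         toℚ (+ 2) ℚ.* (V₀ n ℚ.+ (ℚ.- 1ℚ ℚ.* V₁ n ℚ.+ (V₂ n ℚ.+ ℚ.- 1ℚ ℚ.* V₃ n))))
    ≡⟨ cong (¼ ℚ.*_) (solve 4 (λ x y u v →
         (x :+ (y :+ (con (ℚ.- 1ℚ) :* u :+ con (ℚ.- 1ℚ) :* v))) :-
         con (toℚ (+ 2)) :* (x :+ (con (ℚ.- 1ℚ) :* y :+ (u :+ con (ℚ.- 1ℚ) :* v))) :=
         ((con (ℚ.- 1ℚ) :* x :+ con (toℚ (+ 3)) :* y) :+ con (toℚ (ℤ.- + 3)) :* u) :+ con 1ℚ :* v) refl
         (V₀ n) (V₁ n) (V₂ n) (V₃ n)) ⟩
  ¼ ℚ.* (((toℚ (ℤ.- + 1) ℚ.* V₀ n ℚ.+ toℚ (+ 3) ℚ.* V₁ n) ℚ.+ toℚ (ℤ.- + 3) ℚ.* V₂ n) ℚ.+ toℚ (+ 1) ℚ.* V₃ n)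
    ≡⟨ QT.ϑ-coeff ¼ (toℚ (ℤ.- + 1)) (toℚ (+ 3)) (toℚ (ℤ.- + 3)) (toℚ (+ 1)) n ⟨
  ϑ₄ (ℤ.- + 1) (+ 3) (ℤ.- + 3) (+ 1) n ∎
  where
  open ≡-Reasoning
  open +-*-Solver

D_C-3 : ∀ n → D_C (+ 3) 4 n ≡ ϑ₄ (ℤ.- + 1) (ℤ.- + 1) (+ 1) (+ 1) n
D_C-3 n = begin
  D_C (+ 3) 4 n
    ≡⟨ D_C-coeff (+ 3) n ⟩
  c₃ n ℚ.- (((c₀ n ℚ.+ c₁ n) ℚ.+ c₂ n) ℚ.+ c₃ n) ℚ.* ¼
    -- 4 c₃ - P = -B holds only by c₁ = c₃: c₁ is eliminated for the ring identity and put back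
    -- afterwards to recognise the alternating sum.
    ≡⟨ cong (λ y → c₃ n ℚ.- (((c₀ n ℚ.+ y) ℚ.+ c₂ n) ℚ.+ c₃ n) ℚ.* ¼) (c₁≡c₃ n) ⟩
  c₃ n ℚ.- (((c₀ n ℚ.+ c₃ n) ℚ.+ c₂ n) ℚ.+ c₃ n) ℚ.* ¼
    ≡⟨ solve 3 (λ x u v → v :- (((x :+ v) :+ u) :+ v) :* con ¼ :=
                 con ¼ :* (:- (((x :- v) :+ u) :- v))) refl (c₀ n) (c₂ n) (c₃ n) ⟩
  ¼ ℚ.* (ℚ.- (((c₀ n ℚ.- c₃ n) ℚ.+ c₂ n) ℚ.- c₃ n))
    ≡⟨ cong (λ y → ¼ ℚ.* (ℚ.- (((c₀ n ℚ.- y) ℚ.+ c₂ n) ℚ.- c₃ n))) (c₁≡c₃ n) ⟨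
  ¼ ℚ.* (ℚ.- (((c₀ n ℚ.- c₁ n) ℚ.+ c₂ n) ℚ.- c₃ n))
    ≡⟨ cong (λ s → ¼ ℚ.* (ℚ.- s)) (alternating-identity n) ⟩
  ¼ ℚ.* (ℚ.- (V₀ n ℚ.+ (V₁ n ℚ.+ (ℚ.- 1ℚ ℚ.* V₂ n ℚ.+ ℚ.- 1ℚ ℚ.* V₃ n))))
    ≡⟨ cong (¼ ℚ.*_) (solve 4 (λ x y u v →
         :- (x :+ (y :+ (con (ℚ.- 1ℚ) :* u :+ con (ℚ.- 1ℚ) :* v))) :=
         ((con (ℚ.- 1ℚ) :* x :+ con (ℚ.- 1ℚ) :* y) :+ con 1ℚ :* u) :+ con 1ℚ :* v) refl
         (V₀ n) (V₁ n) (V₂ n) (V₃ n)) ⟩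
  ¼ ℚ.* (((toℚ (ℤ.- + 1) ℚ.* V₀ n ℚ.+ toℚ (ℤ.- + 1) ℚ.* V₁ n) ℚ.+ toℚ (+ 1) ℚ.* V₂ n) ℚ.+ toℚ (+ 1) ℚ.* V₃ n)
    ≡⟨ QT.ϑ-coeff ¼ (toℚ (ℤ.- + 1)) (toℚ (ℤ.- + 1)) (toℚ (+ 1)) (toℚ (+ 1)) n ⟨
  ϑ₄ (ℤ.- + 1) (ℤ.- + 1) (+ 1) (+ 1) n ∎
  where
  open ≡-Reasoning
  open +-*-Solver

theorem1p5 : ((n : ℕ) → D_C (+ 0) 4 n ≡ ϑ₄ (+ 3) (- + 1) (+ 1) (- + 3) n)
    × ((n : ℕ) → D_C (+ 1) 4 n ≡ D_C (+ 3) 4 n)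
    × ((n : ℕ) → D_C (+ 3) 4 n ≡ ϑ₄ (- + 1) (- + 1) (+ 1) (+ 1) n)
    × ((n : ℕ) → D_C (+ 2) 4 n ≡ ϑ₄ (- + 1) (+ 3) (- + 3) (+ 1) n)
theorem1p5 = D_C-0 , (λ n → cong (λ x → x ℚ.- (+ p n ℚ./ 4)) (c₁≡c₃ n)) , D_C-3 , D_C-2
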